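{- Let $\mathcal{T}$ be a tree on $k\geq 2$ vertices, and let $G_1,\dots,G_k$ be trees. Then the minimum of $\kappa(G)$ over all chains $G$ of $G_1,\dots,G_k$ with respect to $\mathcal{T}$ is attained by $G$ if and only if for each bridge $x\sim y\in\mathcal{B}_G$, $x$ and $y$ are centroids of $G_x$ and $G_y$, respectively, and for each $i\in\{1,\dots,k\}$ the set of vertices of $G_i$ that are incident to a bridge in $\mathcal{B}_G$ is a singleton.
   Context: All graphs are finite, simple and undirected. For a connected graph $H$ with $m_H$ edges, Kemeny's constant is that of the simple random walk on $H$ (from a vertex, move to a uniformly random neighbour): $\kappa(H)=\sum_{j\neq i}\pi_jm_{i,j}$, where $\pi_j=\deg_H(j)/(2m_H)$ is the stationary distribution and $m_{i,j}$ is the mean first passage time from $i$ to $j$; it does not depend on the choice of the vertex $i$. A vertex $v$ of a tree on $n$ vertices is a centroid if each connected component left after deleting $v$ contains at most $\lfloor n/2\rfloor$ vertices. Chain: let $\mathcal{T}$ be a tree with vertex set $\{1,\dots,k\}$ and $G_1,\dots,G_k$ connected graphs (on disjoint vertex sets). A chain of $G_1,\dots,G_k$ with respect to $\mathcal{T}$ is a graph $G$ obtained from the disjoint union of $G_1,\dots,G_k$ by choosing, for each edge $i\sim j$ of $\mathcal{T}$, some vertex $v_i\in V(G_i)$ and some vertex $v_j\in V(G_j)$ and adding the edge $v_i\sim v_j$ (the choices for different edges of $\mathcal{T}$ are independent; the same vertex may be chosen several times). $\mathcal{B}_G$ is the set of the $k-1$ added edges; each is a bridge of $G$. For a vertex $z$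 of $G$, $G_z$ denotes the graph $G_j$ with $z\in V(G_j)$. -}

module Defs where

open import Data.Fin.Base using (Fin)
import Data.Fin.Properties as Fin
open import Data.Integer.Base using (+_)
open import Data.List.Base using (List; []; _∷_; [_]; _++_; map; foldr; filter; length; concatMap; upTo; allFin)
open import Data.List.Membership.Propositional using (_∈_; lose)
open import Data.List.Membership.Propositional.Properties
  using (∈-allFin; ∈-map⁺; ∈-map⁻; ∈-concatMap⁺)
import Data.List.Relation.Unary.All as All
import Data.List.Relation.Unary.All.Properties as All
import Data.List.Relation.Unary.AllPairs as AllPairs
import Data.List.Relation.Unary.AllPairs.Properties as AllPairs
open import Data.List.Relation.Unary.Unique.Propositional using (Unique)
import Data.List.Relation.Unary.Unique.Propositional.Properties as Unique
open import Data.Nat.Base as ℕ using (ℕ; zero; suc; ⌊_/2⌋)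
open import Data.Product.Base using (Σ; ∃-syntax; _×_; _,_; proj₁; proj₂; uncurry)
import Data.Product.Properties as Product
open import Data.Rational.Base as ℚ using (ℚ; 0ℚ; _+_; _*_; _-_; _<_; _≤_; ∣_∣)
open import Data.Sum.Base using (_⊎_; inj₁; inj₂)
open import Function.Base using (_∘_)
open import Function.Bundles using (_⇔_)
open import Relation.Binary.Construct.Closure.ReflexiveTransitive using (Star; ε; _◅_)
open import Relation.Binary.Definitions using (DecidableEquality; Decidable; Symmetric; Irreflexive)
open import Relation.Binary.PropositionalEquality
  using (_≡_; _≢_; refl; sym; cong; subst)
open import Relation.Nullary.Decidable using (yes; no; does; map′; ¬?; _×-dec_; _⊎-dec_)
open import Relation.Nullary.Negation using (¬_)
open import Data.Bool.Base using (if_then_else_)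
open import Axiom.UniquenessOfIdentityProofs using (module Decidable⇒UIP)

------------------------------------------------------------------------
-- Finite sets

record FinSet : Set₁ where
  infix 4 _≟_
  field
    Carrier  : Set
    _≟_      : DecidableEquality Carrier
    elements : List Carrier
    complete : ∀ x → x ∈ elements
    unique   : Unique elements

  size : ℕ
  size = length elements

open FinSet using (Carrier; elements; size)

fin : ℕ → FinSet
fin k = record
  { Carrier  = Fin k
  ; _≟_      = Fin._≟_
  ; elements = allFin k
  ; complete = ∈-allFin
  ; unique   = Unique.allFin⁺ k
  }

disjointUnion : (I : FinSet) → (Carrier I → FinSet) → FinSet
disjointUnion I V = record
  { Carrier  = Σ (Carrier I) (Carrier ∘ V)
  ; _≟_      = Product.≡-dec (FinSet._≟_ I) (λ {i} → FinSet._≟_ (V i))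
  ; elements = concatMap fibre (elements I)
  ; complete = λ (i , v) → ∈-concatMap⁺ fibre
      (lose (FinSet.complete I i) (∈-map⁺ (i ,_) (FinSet.complete (V i) v)))
  ; unique   = Unique.concat⁺
      (All.map⁺ (All.universal
        (λ i → Unique.map⁺ (,-injʳ i) (FinSet.unique (V i))) (elements I)))
      (AllPairs.map⁺ (AllPairs.map
        (λ {i} {j} i≢j {x} (p , q) → i≢j (sameFibre {i} {j} p q)) (FinSet.unique I)))
  }
  where
  fibre : (i : Carrier I) → List (Σ (Carrier I) (Carrier ∘ V))
  fibre i = map (i ,_) (elements (V i))

  ,-injʳ : ∀ i {u v : Carrier (V i)} → _≡_ {A = Σ (Carrier I) (Carrier ∘ V)} (i , u) (i , v) → u ≡ v
  ,-injʳ _ = Product.,-injectiveʳ-UIP (Decidable⇒UIP.≡-irrelevant (FinSet._≟_ I))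

  sameFibre : ∀ {i j x} → x ∈ fibre i → x ∈ fibre j → i ≡ j
  sameFibre p q with ∈-map⁻ _ p | ∈-map⁻ _ q
  ... | _ , _ , refl | _ , _ , x≡ = cong proj₁ x≡

------------------------------------------------------------------------
-- Graphs, trees, centroids

-- For a repetition-free list, each unordered pair of distinct entries once.
pairs : {A : Set} → List A → List (A × A)
pairs []       = []
pairs (x ∷ xs) = map (x ,_) xs ++ pairs xs

record Graph (V : FinSet) : Set₁ where
  field
    Adj        : Carrier V → Carrier V → Set
    adj?       : Decidable Adj
    adj-sym    : Symmetric Adj
    adj-irrefl : Irreflexive _≡_ Adj

module _ {V : FinSet} (H : Graph V) where
  open Graph H

  degree : Carrier V → ℕ
  degree v = length (filter (adj? v) (elements V))

  edgeCount : ℕ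
  edgeCount = length (filter (uncurry adj?) (pairs (elements V)))

  Walk : Carrier V → Carrier V → Set
  Walk = Star Adj

  visited : ∀ {u v} → Walk u v → List (Carrier V)
  visited {u} ε       = [ u ]
  visited {u} (_ ◅ w) = u ∷ visited w

  Connected : Set
  Connected = Carrier V × (∀ u v → Walk u v)

  -- A cycle is an edge u ~ v closed up by a path from v to u with at least
  -- three (pairwise distinct) vertices.
  Acyclic : Set
  Acyclic = ∀ {u v} → Adj u v → (w : Walk v u) →
            Unique (visited w) → ¬ (3 ℕ.≤ length (visited w))

  IsTree : Set
  IsTree = Connected × Acyclic

  AdjAvoiding : Carrier V → Carrier V → Carrier V → Set
  AdjAvoiding v x y = x ≢ v × y ≢ v × Adj x y

  -- C lists, without repetition, the component of H − v containing some u ≢ v.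
  IsComponentWithout : Carrier V → List (Carrier V) → Set
  IsComponentWithout v C =
    Unique C × ∃[ u ] (u ≢ v × (∀ w → w ∈ C ⇔ Star (AdjAvoiding v) u w))

  IsCentroid : Carrier V → Set
  IsCentroid v = ∀ C → IsComponentWithout v C → length C ℕ.≤ ⌊ size V /2⌋

------------------------------------------------------------------------
-- Kemeny's constant

sumOver : {A : Set} → List A → (A → ℚ) → ℚ
sumOver xs f = foldr (λ x s → f x + s) 0ℚ xs

-- The quotient a / b, with the convention a / 0 = 0.  A zero denominator does
-- not occur in a connected graph with at least two vertices.
ratio : ℕ → ℕ → ℚ
ratio a zero    = 0ℚ
ratio a (suc b) = + a ℚ./ suc b

_⟶_ : (ℕ → ℚ) → ℚ → Set
s ⟶ l = ∀ ε → 0ℚ < ε → ∃[ N ] (∀ n → N ℕ.≤ n → ∣ s n - l ∣ < ε)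

module _ {V : FinSet} (H : Graph V) where
  open FinSet V using (_≟_)
  open Graph H

  transition : Carrier V → Carrier V → ℚ
  transition u v = if does (adj? u v) then ratio 1 (degree H u) else 0ℚ

  stationary : Carrier V → ℚ
  stationary j = ratio (degree H j) (2 ℕ.* edgeCount H)

  others : Carrier V → List (Carrier V)
  others j = filter (λ l → ¬? (l ≟ j)) (elements V)

  -- Probability that the walk started at i visits j at time t and at no time
  -- strictly between 0 and t.
  firstPassage : (i j : Carrier V) → (t : ℕ) → ℚ
  firstPassage i j 0             = 0ℚ
  firstPassage i j 1             = transition i j
  firstPassage i j (suc (suc t)) =
    sumOver (others j) (λ l → transition i l * firstPassage l j (suc t))

  -- The expectation Σₜ t · P(first passage at time t).  In a connected graph
  -- the passage time is almost surely finite and its mean is rational.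
  IsMeanFirstPassageTime : (i j : Carrier V) → ℚ → Set
  IsMeanFirstPassageTime i j m =
    (λ n → sumOver (upTo n) (λ t → ratio t 1 * firstPassage i j t)) ⟶ m

  -- The sum has the value κ for every choice of the starting vertex i.
  IsKemeny : ℚ → Set
  IsKemeny κ = ∀ i → Σ (Carrier V → ℚ) λ m →
    ( (∀ j → j ≢ i → IsMeanFirstPassageTime i j (m j))
    × κ ≡ sumOver (others i) (λ j → stationary j * m j) )

_κ≤_ : {V W : FinSet} → Graph V → Graph W → Set
G κ≤ H = ∃[ κ ] ∃[ κ′ ] (IsKemeny G κ × IsKemeny H κ′ × κ ≤ κ′)

------------------------------------------------------------------------
-- Chains

ChainVertex : {k : ℕ} → (Fin k → FinSet) → FinSet
ChainVertex V = disjointUnion (fin _) V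

module _ {k : ℕ} {V : Fin k → FinSet} (G : ∀ i → Graph (V i)) where
  open Graph

  data Inner : Carrier (ChainVertex V) → Carrier (ChainVertex V) → Set where
    inner : ∀ {i u v} → Adj (G i) u v → Inner (i , u) (i , v)

  inner? : Decidable Inner
  inner? (i , u) (j , v) with i Fin.≟ j
  ... | no i≢j   = no λ { (inner _) → i≢j refl }
  ... | yes refl = map′ inner (λ p → uninner p refl) (adj? (G i) u v)
    where
    uninner : ∀ {i j u v} → Inner (i , u) (j , v) → (p : i ≡ j) →
              Adj (G j) (subst (Carrier ∘ V) p u) v
    uninner (inner a) p with refl ← Decidable⇒UIP.≡-irrelevant Fin._≟_ p refl = a

  inner-irrefl : ∀ {x y} → x ≡ y → ¬ Inner x y
  inner-irrefl x≡y (inner {i} a) = adj-irrefl (G i)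
    (Product.,-injectiveʳ-UIP {B = Carrier ∘ V} (Decidable⇒UIP.≡-irrelevant Fin._≟_) x≡y) a

-- attach i j is the endpoint in G i of the edge added for i ~ j.  It is
-- irrelevant in the proof of i ~ j, so one edge is added per edge of 𝒯.
record Chain {k : ℕ} (𝒯 : Graph (fin k)) {V : Fin k → FinSet} (G : ∀ i → Graph (V i)) : Set where
  field
    attach : ∀ i j → .(Graph.Adj 𝒯 i j) → Carrier (V i)

module _ {k : ℕ} {𝒯 : Graph (fin k)} {V : Fin k → FinSet} {G : ∀ i → Graph (V i)} where
  open Graph
  open Chain

  data Bridge (C : Chain 𝒯 G) : Carrier (ChainVertex V) → Carrier (ChainVertex V) → Set where
    bridge : ∀ {i j} (e : Adj 𝒯 i j) →
             Bridge C (i , attach C i j e) (j , attach C j i (adj-sym 𝒯 e))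

  bridge? : ∀ C → Decidable (Bridge C)
  bridge? C (i , u) (j , v) with adj? 𝒯 i j
  ... | no ¬e = no λ { (bridge e) → ¬e e }
  ... | yes e = map′ (λ { (refl , refl) → bridge e })
                     (λ { (bridge _) → refl , refl })
                     (FinSet._≟_ (V i) u (attach C i j e)
                       ×-dec FinSet._≟_ (V j) v (attach C j i (adj-sym 𝒯 e)))

  chainGraph : Chain 𝒯 G → Graph (ChainVertex V)
  chainGraph C = record
    { Adj        = λ x y → Inner G x y ⊎ Bridge C x y
    ; adj?       = λ x y → inner? G x y ⊎-dec bridge? C x y
    ; adj-sym    = λ { (inj₁ (inner {i} a)) → inj₁ (inner (adj-sym (G i) a))
                     ; (inj₂ (bridge e))    → inj₂ (bridge (adj-sym 𝒯 e)) }
    ; adj-irrefl = λ { x≡y (inj₁ p)          → inner-irrefl G x≡y p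
                     ; x≡y (inj₂ (bridge e)) → adj-irrefl 𝒯 (cong proj₁ x≡y) e }
    }

  AttainsMinimum : Chain 𝒯 G → Set
  AttainsMinimum C = ∀ (C′ : Chain 𝒯 G) → chainGraph C κ≤ chainGraph C′

  BridgesJoinCentroids : Chain 𝒯 G → Set
  BridgesJoinCentroids C = ∀ {x y} → Bridge C x y →
    IsCentroid (G (proj₁ x)) (proj₂ x) × IsCentroid (G (proj₁ y)) (proj₂ y)

  BridgeVertex : Chain 𝒯 G → (i : Fin k) → Carrier (V i) → Set
  BridgeVertex C i u = ∃[ y ] Bridge C (i , u) y

  BridgeVerticesSingleton : Chain 𝒯 G → Set
  BridgeVerticesSingleton C = ∀ i → ∃[ v ] (∀ u → BridgeVertex C i u ⇔ u ≡ v)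

module Submission where

-- For a tree H with n vertices and distance d, let D(x) = Σ_z d(x,z).  Towards
-- any z ≢ x exactly one neighbour of x is closer to z and all others are farther,
-- so the Laplacian of d(·,z) is explicit; it follows that the mean first passage
-- times are m(i,j) = (n − 1) d(i,j) + D(j) − D(i), and that
-- 2(n − 1) κ(H) = 2 Σ_x D(x) − (2n − 1)(n − 1).  All chains have the same number
-- of vertices, so minimising κ amounts to minimising Σ_x D(x).  In a chain, the sum
-- of the distances between V(G_i) and V(G_j) with i ≢ j is at least
-- n_j c_i + n_i (n_j d_𝒯(i,j) + c_j), where n_i is the order and c_i the minimal
-- transmission of G_i.  Equality for all i, j means that every G_i is attached at
-- medians only and that no path of the chain makes a step inside an intermediate
-- G_i; and the medians of a tree are its centroids.

open import Defs
open import Data.Nat.Base using (ℕ; _≤_)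
open import Data.Fin.Base using (Fin)
open import Data.Product.Base using (_×_)
open import Function.Bundles using (_⇔_)

open import Algebra.Bundles using (CommutativeSemigroup)
open import Algebra.Core using (Op₂)
import Algebra.Properties.CommutativeSemigroup as CommutativeSemigroupProperties
import Algebra.Structures as Structures
open import Data.Bool.Base using (true; false; if_then_else_)
import Data.Fin.Base as Fin
import Data.Fin.Properties as Fin
import Data.Integer.Base as ℤ
import Data.Integer.Properties as ℤ
open import Data.List.Base
  using (List; []; _∷_; [_]; _++_; map; foldr; filter; length; concatMap; upTo; allFin)
open import Data.List.Membership.Propositional using (_∈_; _∉_)
import Data.List.Membership.DecPropositional as DecMembership
open import Data.List.Membership.Propositional.Properties
  using (∈-allFin; ∈-filter⁺; ∈-filter⁻; ∈-length; ∈-∃++; ∈-++⁺ˡ; ∈-++⁺ʳ; ∈-++⁻)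
open import Data.List.Properties using (upTo-∷ʳ; length-++)
open import Data.List.Relation.Unary.All using (All; []; _∷_)
import Data.List.Relation.Unary.All as All
open import Data.List.Relation.Unary.AllPairs using ([]; _∷_)
open import Data.List.Relation.Unary.Any using (here; there)
open import Data.List.Relation.Unary.Unique.Propositional using (Unique)
import Data.List.Relation.Unary.Unique.Propositional.Properties as Unique
open import Data.Nat.Base as ℕ using (zero; suc; z≤n; s≤s; ⌊_/2⌋)
import Data.Nat.Properties as ℕ
open import Data.List.Extrema ℕ.≤-totalOrder using (argmin; f[argmin]≤f[xs])
open import Data.Product.Base using (Σ; ∃-syntax; _,_; proj₁; proj₂; uncurry)
open import Data.Rational.Base as ℚ using (ℚ; 0ℚ; 1ℚ)
import Data.Rational.Properties as ℚ
import Data.Rational.Solver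
import Data.Rational.Unnormalised.Base as ℚᵘ
import Data.Rational.Unnormalised.Properties as ℚᵘ
open import Data.Sum.Base using (_⊎_; inj₁; inj₂)
open import Function.Base using (_∘_)
open import Function.Bundles using (mk⇔; Equivalence)
open import Relation.Binary.Construct.Closure.ReflexiveTransitive as Star using (Star; ε; _◅_; _◅◅_)
open import Relation.Binary.Definitions using (DecidableEquality)
open import Relation.Binary.PropositionalEquality hiding ([_])
open import Relation.Nullary.Decidable using (Dec; yes; no; does; dec-true; dec-false; ¬?)
open import Relation.Nullary.Negation using (¬_; contradiction)
open import Relation.Unary using (Decidable)

open FinSet using (Carrier; elements; size)

-- `IsMeanFirstPassageTime` is a limit statement about partial sums of t P(T = t), so solving the
-- one-step equations does not settle it: the series has to be shown to converge to the solution. A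
-- solution that is bounded and everywhere at least 1 allows this, which is why the passage times
-- are kept as natural numbers. Since `_κ≤_` quantifies over the values of Kemeny's constant,
-- uniqueness of limits is needed as well. Connectedness and acyclicity of a chain are bypassed: its
-- distance is written down by recursion along 𝒯 and checked against the interface `TreeMetric`,
-- which the given trees satisfy by loop erasure. The sum of all distances splits over pairs (i,j).
-- Its diagonal terms are common to all chains, and attaching every bridge at one chosen median per
-- G_i meets all off-diagonal bounds at once; hence a minimal chain must meet each of them.

private variable
  A B : Set

-- Finite sums

module Summation {R : Set} {_+_ _*_ : Op₂ R} {0# 1# : R}
  (isCommutativeSemiring : Structures.IsCommutativeSemiring _≡_ _+_ _*_ 0# 1#) where

  open Structures.IsCommutativeSemiring isCommutativeSemiring
    using (+-assoc; +-isCommutativeMonoid; +-identityˡ; +-identityʳ; *-identityˡ; distribˡ; zeroˡ; zeroʳ)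
  open Structures.IsCommutativeMonoid +-isCommutativeMonoid using (isCommutativeSemigroup)

  +-commutativeSemigroup : CommutativeSemigroup _ _
  +-commutativeSemigroup = record { isCommutativeSemigroup = isCommutativeSemigroup }

  open CommutativeSemigroupProperties +-commutativeSemigroup using (interchange)
  open ≡-Reasoning

  -- Over ℚ this is definitionally `sumOver`, so the laws below apply directly to the sums in the
  -- definitions.
  ∑ : List A → (A → R) → R
  ∑ xs f = foldr (λ x s → f x + s) 0# xs

  𝟙 : {P : Set} → Dec P → R
  𝟙 P? = if does P? then 1# else 0#

  𝟙-yes : {P : Set} (P? : Dec P) → P → 𝟙 P? ≡ 1#
  𝟙-yes P? p = cong (if_then 1# else 0#) (dec-true P? p)

  𝟙-no : {P : Set} (P? : Dec P) → ¬ P → 𝟙 P? ≡ 0#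
  𝟙-no P? ¬p = cong (if_then 1# else 0#) (dec-false P? ¬p)

  𝟙-cong : {P Q : Set} (P? : Dec P) (Q? : Dec Q) → (P → Q) → (Q → P) → 𝟙 P? ≡ 𝟙 Q?
  𝟙-cong (yes p) Q? f g = sym (𝟙-yes Q? (f p))
  𝟙-cong (no ¬p) Q? f g = sym (𝟙-no Q? (λ q → ¬p (g q)))

  ∑-cong-∈ : (xs : List A) {f g : A → R} → (∀ x → x ∈ xs → f x ≡ g x) → ∑ xs f ≡ ∑ xs g
  ∑-cong-∈ []       f≗g = refl
  ∑-cong-∈ (x ∷ xs) f≗g = cong₂ _+_ (f≗g x (here refl)) (∑-cong-∈ xs (λ y y∈ → f≗g y (there y∈)))

  ∑-cong : (xs : List A) {f g : A → R} → (∀ x → f x ≡ g x) → ∑ xs f ≡ ∑ xs g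
  ∑-cong xs f≗g = ∑-cong-∈ xs (λ x _ → f≗g x)

  ∑-zero : (xs : List A) → ∑ xs (λ _ → 0#) ≡ 0#
  ∑-zero []       = refl
  ∑-zero (x ∷ xs) = trans (+-identityˡ _) (∑-zero xs)

  ∑-+ : (xs : List A) (f g : A → R) → ∑ xs (λ x → f x + g x) ≡ ∑ xs f + ∑ xs g
  ∑-+ []       f g = sym (+-identityˡ 0#)
  ∑-+ (x ∷ xs) f g = trans (cong ((f x + g x) +_) (∑-+ xs f g)) (interchange _ _ _ _)

  ∑-*ˡ : (xs : List A) (c : R) (f : A → R) → ∑ xs (λ x → c * f x) ≡ c * ∑ xs f
  ∑-*ˡ []       c f = sym (zeroʳ c)
  ∑-*ˡ (x ∷ xs) c f = trans (cong ((c * f x) +_) (∑-*ˡ xs c f)) (sym (distribˡ c _ _))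

  ∑-swap : (xs : List A) (ys : List B) (f : A → B → R) →
           ∑ xs (λ x → ∑ ys (f x)) ≡ ∑ ys (λ y → ∑ xs (λ x → f x y))
  ∑-swap []       ys f = sym (∑-zero ys)
  ∑-swap (x ∷ xs) ys f = trans (cong (∑ ys (f x) +_) (∑-swap xs ys f)) (sym (∑-+ ys _ _))

  ∑-++ : (xs ys : List A) (f : A → R) → ∑ (xs ++ ys) f ≡ ∑ xs f + ∑ ys f
  ∑-++ []       ys f = sym (+-identityˡ _)
  ∑-++ (x ∷ xs) ys f = trans (cong (f x +_) (∑-++ xs ys f)) (sym (+-assoc _ _ _))

  ∑-map : (g : B → A) (xs : List B) (f : A → R) → ∑ (map g xs) f ≡ ∑ xs (λ x → f (g x))
  ∑-map g []       f = refl
  ∑-map g (x ∷ xs) f = cong (f (g x) +_) (∑-map g xs f)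

  ∑-concatMap : (g : B → List A) (xs : List B) (f : A → R) →
                ∑ (concatMap g xs) f ≡ ∑ xs (λ x → ∑ (g x) f)
  ∑-concatMap g []       f = refl
  ∑-concatMap g (x ∷ xs) f = trans (∑-++ (g x) _ f) (cong (∑ (g x) f +_) (∑-concatMap g xs f))

  ∑-filter : {P : A → Set} (P? : Decidable P) (xs : List A) (f : A → R) →
             ∑ (filter P? xs) f ≡ ∑ xs (λ x → 𝟙 (P? x) * f x)
  ∑-filter P? []       f = refl
  ∑-filter P? (x ∷ xs) f with does (P? x)
  ... | true  = cong₂ _+_ (sym (*-identityˡ _)) (∑-filter P? xs f)
  ... | false = trans (∑-filter P? xs f)
                      (sym (trans (cong (_+ ∑ xs (λ x → 𝟙 (P? x) * f x)) (zeroˡ (f x))) (+-identityˡ _)))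

  ∑-point : (_≟_ : DecidableEquality A) (xs : List A) → Unique xs → ∀ {y} → y ∈ xs →
            (f : A → R) → ∑ xs (λ x → 𝟙 (x ≟ y) * f x) ≡ f y
  ∑-point _≟_ (x ∷ xs) (x∉ ∷ _) {y} (here refl) f = begin
    (𝟙 (y ≟ y) * f y) + ∑ xs (λ x → 𝟙 (x ≟ y) * f x)
      ≡⟨ cong₂ (λ a b → (a * f y) + b) (𝟙-yes (y ≟ y) refl)
           (∑-cong-∈ xs λ z z∈ → trans (cong (_* f z) (𝟙-no (z ≟ y) λ z≡y → All.lookup x∉ z∈ (sym z≡y))) (zeroˡ _)) ⟩
    (1# * f y) + ∑ xs (λ _ → 0#)
      ≡⟨ cong₂ _+_ (*-identityˡ _) (∑-zero xs) ⟩
    f y + 0#  ≡⟨ +-identityʳ _ ⟩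
    f y       ∎
  ∑-point _≟_ (x ∷ xs) (x∉ ∷ u) {y} (there y∈) f = begin
    (𝟙 (x ≟ y) * f x) + ∑ xs (λ x → 𝟙 (x ≟ y) * f x)
      ≡⟨ cong₂ (λ a b → (a * f x) + b) (𝟙-no (x ≟ y) (All.lookup x∉ y∈)) (∑-point _≟_ xs u y∈ f) ⟩
    (0# * f x) + f y  ≡⟨ cong (_+ f y) (zeroˡ _) ⟩
    0# + f y          ≡⟨ +-identityˡ _ ⟩
    f y               ∎

module ∑ℚ = Summation
  (Structures.IsCommutativeRing.isCommutativeSemiring ℚ.+-*-isCommutativeRing)
module ∑ℕ = Summation ℕ.+-*-isCommutativeSemiring

∑-mono-≤ : (xs : List A) {f g : A → ℕ} → (∀ x → f x ℕ.≤ g x) → ∑ℕ.∑ xs f ℕ.≤ ∑ℕ.∑ xs g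
∑-mono-≤ []       f≤g = z≤n
∑-mono-≤ (x ∷ xs) f≤g = ℕ.+-mono-≤ (f≤g x) (∑-mono-≤ xs f≤g)

-- Cancelling the other summands, which are ordered termwise, leaves the reverse inequality for a
-- single one. This carries minimality of a sum over to each of its terms.
∑-≤⇒≗ : (xs : List A) {f g : A → ℕ} → (∀ x → f x ℕ.≤ g x) → ∑ℕ.∑ xs g ℕ.≤ ∑ℕ.∑ xs f →
        ∀ {x} → x ∈ xs → g x ≡ f x
∑-≤⇒≗ (x ∷ xs) {f} {g} f≤g ∑g≤∑f (here refl) = ℕ.≤-antisym
  (ℕ.+-cancelʳ-≤ (∑ℕ.∑ xs g) (g x) (f x)
    (ℕ.≤-trans ∑g≤∑f (ℕ.+-monoʳ-≤ (f x) (∑-mono-≤ xs f≤g))))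
  (f≤g x)
∑-≤⇒≗ (x ∷ xs) {f} {g} f≤g ∑g≤∑f (there y∈) = ∑-≤⇒≗ xs f≤g
  (ℕ.+-cancelˡ-≤ (f x) _ _ (ℕ.≤-trans (ℕ.+-monoˡ-≤ (∑ℕ.∑ xs g) (f≤g x)) ∑g≤∑f)) y∈

∑ℕ-const : (xs : List A) (c : ℕ) → ∑ℕ.∑ xs (λ _ → c) ≡ length xs ℕ.* c
∑ℕ-const []       c = refl
∑ℕ-const (x ∷ xs) c = cong (c ℕ.+_) (∑ℕ-const xs c)

∑ℕ-𝟙 : {P : A → Set} (P? : Decidable P) (xs : List A) →
       ∑ℕ.∑ xs (λ x → ∑ℕ.𝟙 (P? x)) ≡ length (filter P? xs)
∑ℕ-𝟙 P? []       = refl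
∑ℕ-𝟙 P? (x ∷ xs) with does (P? x)
... | true  = cong suc (∑ℕ-𝟙 P? xs)
... | false = ∑ℕ-𝟙 P? xs

-- Embedding of the natural numbers into the rationals

opaque
  -- Opaque, so that conversion checking does not unfold the normalisation of fractions; outside
  -- this block only the laws proved in it are available.
  ι : ℕ → ℚ
  ι n = ratio n 1

  ι≡ratio : ∀ n → ι n ≡ ratio n 1
  ι≡ratio n = refl

  ι-0 : ι 0 ≡ 0ℚ
  ι-0 = refl

  ι-1 : ι 1 ≡ 1ℚ
  ι-1 = refl

  toℚᵘ-ι : ∀ n → ℚ.toℚᵘ (ι n) ℚᵘ.≃ ℚᵘ.mkℚᵘ (ℤ.+ n) 0
  toℚᵘ-ι n = ℚ.toℚᵘ-fromℚᵘ (ℚᵘ.mkℚᵘ (ℤ.+ n) 0)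

  ι-+ : ∀ m n → ι (m ℕ.+ n) ≡ ι m ℚ.+ ι n
  ι-+ m n = ℚ.toℚᵘ-injective (begin
    ℚ.toℚᵘ (ι (m ℕ.+ n))                              ≈⟨ toℚᵘ-ι (m ℕ.+ n) ⟩
    ℚᵘ.mkℚᵘ (ℤ.+ (m ℕ.+ n)) 0                         ≈⟨ ℚᵘ.*≡* (cong (ℤ._* ℤ.+ 1) (trans (ℤ.pos-+ m n)
                                                           (sym (cong₂ ℤ._+_ (ℤ.*-identityʳ (ℤ.+ m)) (ℤ.*-identityʳ (ℤ.+ n)))))) ⟩
    ℚᵘ.mkℚᵘ (ℤ.+ m) 0 ℚᵘ.+ ℚᵘ.mkℚᵘ (ℤ.+ n) 0           ≈⟨ ℚᵘ.+-cong (toℚᵘ-ι m) (toℚᵘ-ι n) ⟨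
    ℚ.toℚᵘ (ι m) ℚᵘ.+ ℚ.toℚᵘ (ι n)                    ≈⟨ ℚ.toℚᵘ-homo-+ (ι m) (ι n) ⟨
    ℚ.toℚᵘ (ι m ℚ.+ ι n)                              ∎)
    where open ℚᵘ.≃-Reasoning

  ι-* : ∀ m n → ι (m ℕ.* n) ≡ ι m ℚ.* ι n
  ι-* m n = ℚ.toℚᵘ-injective (begin
    ℚ.toℚᵘ (ι (m ℕ.* n))                              ≈⟨ toℚᵘ-ι (m ℕ.* n) ⟩
    ℚᵘ.mkℚᵘ (ℤ.+ (m ℕ.* n)) 0                         ≈⟨ ℚᵘ.*≡* (cong (ℤ._* ℤ.+ 1) (ℤ.pos-* m n)) ⟩
    ℚᵘ.mkℚᵘ (ℤ.+ m) 0 ℚᵘ.* ℚᵘ.mkℚᵘ (ℤ.+ n) 0           ≈⟨ ℚᵘ.*-cong (toℚᵘ-ι m) (toℚᵘ-ι n) ⟨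
    ℚ.toℚᵘ (ι m) ℚᵘ.* ℚ.toℚᵘ (ι n)                    ≈⟨ ℚ.toℚᵘ-homo-* (ι m) (ι n) ⟨
    ℚ.toℚᵘ (ι m ℚ.* ι n)                              ∎)
    where open ℚᵘ.≃-Reasoning

  ι-mono-≤ : ∀ {m n} → m ℕ.≤ n → ι m ℚ.≤ ι n
  ι-mono-≤ {m} {n} m≤n = ℚ.toℚᵘ-cancel-≤ (begin
    ℚ.toℚᵘ (ι m)       ≃⟨ toℚᵘ-ι m ⟩
    ℚᵘ.mkℚᵘ (ℤ.+ m) 0  ≤⟨ ℚᵘ.*≤* (ℤ.*-monoʳ-≤-nonNeg (ℤ.+ 1) (ℤ.+≤+ m≤n)) ⟩
    ℚᵘ.mkℚᵘ (ℤ.+ n) 0  ≃⟨ toℚᵘ-ι n ⟨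
    ℚ.toℚᵘ (ι n)       ∎)
    where open ℚᵘ.≤-Reasoning

  ι-cancel-≤ : ∀ {m n} → ι m ℚ.≤ ι n → m ℕ.≤ n
  ι-cancel-≤ {m} {n} le with ℚᵘ.≤-respʳ-≃ (toℚᵘ-ι n) (ℚᵘ.≤-respˡ-≃ (toℚᵘ-ι m) (ℚ.toℚᵘ-mono-≤ le))
  ... | ℚᵘ.*≤* p = ℤ.drop‿+≤+ (ℤ.*-cancelʳ-≤-pos (ℤ.+ m) (ℤ.+ n) (ℤ.+ 1) p)

  -- The law by which quotients are evaluated: they are multiplied by their denominator.
  ratio-*-ι : ∀ a b → ratio a (suc b) ℚ.* ι (suc b) ≡ ι a
  ratio-*-ι a b = ℚ.toℚᵘ-injective (begin
    ℚ.toℚᵘ (ratio a (suc b) ℚ.* ι (suc b))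
      ≈⟨ ℚ.toℚᵘ-homo-* (ratio a (suc b)) (ι (suc b)) ⟩
    ℚ.toℚᵘ (ratio a (suc b)) ℚᵘ.* ℚ.toℚᵘ (ι (suc b))
      ≈⟨ ℚᵘ.*-cong (ℚ.toℚᵘ-fromℚᵘ (ℚᵘ.mkℚᵘ (ℤ.+ a) b)) (toℚᵘ-ι (suc b)) ⟩
    ℚᵘ.mkℚᵘ (ℤ.+ a) b ℚᵘ.* ℚᵘ.mkℚᵘ (ℤ.+ suc b) 0
      ≈⟨ ℚᵘ.*≡* (trans (ℤ.*-identityʳ _) (cong (ℤ.+ a ℤ.*_) (cong ℤ.+_ (sym (ℕ.*-identityʳ (suc b)))))) ⟩
    ℚᵘ.mkℚᵘ (ℤ.+ a) 0
      ≈⟨ toℚᵘ-ι a ⟨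
    ℚ.toℚᵘ (ι a) ∎)
    where open ℚᵘ.≃-Reasoning

ι-mono-< : ∀ {m n} → m ℕ.< n → ι m ℚ.< ι n
ι-mono-< m<n = ℚ.≰⇒> λ ιn≤ιm → ℕ.<⇒≱ m<n (ι-cancel-≤ ιn≤ιm)

*-cancelʳ : ∀ {p q r} → 0ℚ ℚ.< r → p ℚ.* r ≡ q ℚ.* r → p ≡ q
*-cancelʳ {r = r} 0<r pr≡qr = ℚ.≤-antisym
  (ℚ.*-cancelʳ-≤-pos r {{ℚ.positive 0<r}} (ℚ.≤-reflexive pr≡qr))
  (ℚ.*-cancelʳ-≤-pos r {{ℚ.positive 0<r}} (ℚ.≤-reflexive (sym pr≡qr)))

ι-suc : ∀ n → ι (suc n) ≡ 1ℚ ℚ.+ ι n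
ι-suc n = trans (ι-+ 1 n) (cong (ℚ._+ ι n) ι-1)

0≤ι : ∀ n → 0ℚ ℚ.≤ ι n
0≤ι n = subst (ℚ._≤ ι n) ι-0 (ι-mono-≤ z≤n)

0≤* : ∀ {p q} → 0ℚ ℚ.≤ p → 0ℚ ℚ.≤ q → 0ℚ ℚ.≤ p ℚ.* q
0≤* {p} {q} 0≤p 0≤q = subst (ℚ._≤ p ℚ.* q) (ℚ.*-zeroʳ p)
  (ℚ.*-monoˡ-≤-nonNeg p {{ℚ.nonNegative 0≤p}} 0≤q)

ι-∑ : (xs : List A) (f : A → ℕ) → ι (∑ℕ.∑ xs f) ≡ ∑ℚ.∑ xs (λ x → ι (f x))
ι-∑ []       f = ι-0
ι-∑ (x ∷ xs) f = trans (ι-+ (f x) _) (cong (ι (f x) ℚ.+_) (ι-∑ xs f))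

ι-𝟙 : {P : Set} (P? : Dec P) → ι (∑ℕ.𝟙 P?) ≡ ∑ℚ.𝟙 P?
ι-𝟙 P? with does P?
... | true  = ι-1
... | false = ι-0

∑ℚ-const : (xs : List A) (c : ℚ) → ∑ℚ.∑ xs (λ _ → c) ≡ ι (length xs) ℚ.* c
∑ℚ-const []       c = sym (trans (cong (ℚ._* c) ι-0) (ℚ.*-zeroˡ c))
∑ℚ-const (x ∷ xs) c = begin
  c ℚ.+ ∑ℚ.∑ xs (λ _ → c)              ≡⟨ cong₂ ℚ._+_ (sym (ℚ.*-identityˡ c)) (∑ℚ-const xs c) ⟩
  1ℚ ℚ.* c ℚ.+ ι (length xs) ℚ.* c     ≡⟨ ℚ.*-distribʳ-+ c 1ℚ (ι (length xs)) ⟨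
  (1ℚ ℚ.+ ι (length xs)) ℚ.* c         ≡⟨ cong (ℚ._* c) (ι-suc (length xs)) ⟨
  ι (suc (length xs)) ℚ.* c            ∎
  where open ≡-Reasoning

∑ℚ-mono-≤ : (xs : List A) {f g : A → ℚ} → (∀ x → x ∈ xs → f x ℚ.≤ g x) → ∑ℚ.∑ xs f ℚ.≤ ∑ℚ.∑ xs g
∑ℚ-mono-≤ []       f≤g = ℚ.≤-refl
∑ℚ-mono-≤ (x ∷ xs) f≤g = ℚ.+-mono-≤ (f≤g x (here refl)) (∑ℚ-mono-≤ xs (λ y y∈ → f≤g y (there y∈)))

0≤∑ : (xs : List A) {f : A → ℚ} → (∀ x → 0ℚ ℚ.≤ f x) → 0ℚ ℚ.≤ ∑ℚ.∑ xs f
0≤∑ xs {f} 0≤f = subst (ℚ._≤ ∑ℚ.∑ xs f) (∑ℚ.∑-zero xs) (∑ℚ-mono-≤ xs (λ x _ → 0≤f x))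

term≤∑ : (xs : List A) {f : A → ℚ} → (∀ x → 0ℚ ℚ.≤ f x) → ∀ {x} → x ∈ xs → f x ℚ.≤ ∑ℚ.∑ xs f
term≤∑ (x ∷ xs) {f} 0≤f (here refl) = subst (ℚ._≤ ∑ℚ.∑ (x ∷ xs) f) (ℚ.+-identityʳ (f x))
  (ℚ.+-monoʳ-≤ (f x) (0≤∑ xs 0≤f))
term≤∑ (x ∷ xs) {f} 0≤f {y} (there y∈) = subst (ℚ._≤ ∑ℚ.∑ (x ∷ xs) f) (ℚ.+-identityˡ (f y))
  (ℚ.+-mono-≤ (0≤f x) (term≤∑ xs 0≤f y∈))

-- Limits of rational sequences

archimedean : ∀ b {η} → 0ℚ ℚ.< η → ∃[ N ] ι b ℚ.< ι (suc N) ℚ.* η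
archimedean b {ℚ.mkℚ (ℤ.+ 0) d c} 0<η with ℚ.positive 0<η
... | ()
archimedean b {ℚ.mkℚ (ℤ.-[1+ n ]) d c} 0<η with ℚ.positive 0<η
... | ()
archimedean b {η@(ℚ.mkℚ (ℤ.+ (suc p)) d c)} 0<η = N , (begin-strict
  ι b                                 ≡⟨ ℚ.*-identityʳ (ι b) ⟨
  ι b ℚ.* 1ℚ                          ≤⟨ ℚ.*-monoˡ-≤-nonNeg (ι b) {{ℚ.nonNegative (0≤ι b)}} 1≤ ⟩
  ι b ℚ.* (ι (suc d) ℚ.* η)           ≡⟨ ℚ.*-assoc (ι b) (ι (suc d)) η ⟨
  ι b ℚ.* ι (suc d) ℚ.* η             ≡⟨ cong (ℚ._* η) (ι-* b (suc d)) ⟨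
  ι N ℚ.* η                           ≡⟨ ℚ.+-identityˡ _ ⟨
  0ℚ ℚ.+ ι N ℚ.* η                    <⟨ ℚ.+-monoˡ-< (ι N ℚ.* η) 0<η ⟩
  η ℚ.+ ι N ℚ.* η                     ≡⟨ cong (ℚ._+ ι N ℚ.* η) (ℚ.*-identityˡ η) ⟨
  1ℚ ℚ.* η ℚ.+ ι N ℚ.* η              ≡⟨ ℚ.*-distribʳ-+ η 1ℚ (ι N) ⟨
  (1ℚ ℚ.+ ι N) ℚ.* η                  ≡⟨ cong (ℚ._* η) (ι-suc N) ⟨
  ι (suc N) ℚ.* η                     ∎)
  where
  open ℚ.≤-Reasoning
  -- As η = (1 + p)/(1 + d), the product (1 + d) η is at least 1 and N η at least b; the additional
  -- η in `suc N` makes the inequality strict.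
  N = b ℕ.* suc d
  1≤ : 1ℚ ℚ.≤ ι (suc d) ℚ.* η
  1≤ = begin
    1ℚ                                       ≡⟨ ι-1 ⟨
    ι 1                                      ≤⟨ ι-mono-≤ (s≤s z≤n) ⟩
    ι (suc p)                                ≡⟨ ratio-*-ι (suc p) d ⟨
    ratio (suc p) (suc d) ℚ.* ι (suc d)      ≡⟨ cong (ℚ._* ι (suc d)) (ℚ.↥p/↧p≡p η) ⟩
    η ℚ.* ι (suc d)                          ≡⟨ ℚ.*-comm η (ι (suc d)) ⟩
    ι (suc d) ℚ.* η                          ∎

∣p-q∣≡∣q-p∣ : ∀ p q → ℚ.∣ p ℚ.- q ∣ ≡ ℚ.∣ q ℚ.- p ∣
∣p-q∣≡∣q-p∣ p q = trans (sym (ℚ.∣-p∣≡∣p∣ (p ℚ.- q))) (cong ℚ.∣_∣ (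
  solve 2 (λ a b → :- (a :- b) := b :- a) refl p q))
  where open Data.Rational.Solver.+-*-Solver

limit-unique : ∀ {s a b} → s ⟶ a → s ⟶ b → a ≡ b
limit-unique {s} {a} {b} s⟶a s⟶b with a ℚ.≟ b
... | yes a≡b = a≡b
... | no  a≢b = contradiction (begin-strict
  δ ℚ.+ δ                                   ≡⟨ halves ⟩
  ℚ.∣ a ℚ.- b ∣                             ≡⟨ cong ℚ.∣_∣ (solve 3 (λ a b c → a :- b := (a :- c) :+ (c :- b)) refl a b (s n)) ⟩
  ℚ.∣ (a ℚ.- s n) ℚ.+ (s n ℚ.- b) ∣         ≤⟨ ℚ.∣p+q∣≤∣p∣+∣q∣ (a ℚ.- s n) (s n ℚ.- b) ⟩
  ℚ.∣ a ℚ.- s n ∣ ℚ.+ ℚ.∣ s n ℚ.- b ∣        ≡⟨ cong (ℚ._+ ℚ.∣ s n ℚ.- b ∣) (∣p-q∣≡∣q-p∣ a (s n)) ⟩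
  ℚ.∣ s n ℚ.- a ∣ ℚ.+ ℚ.∣ s n ℚ.- b ∣        <⟨ ℚ.+-mono-< (proj₂ (s⟶a δ 0<δ) n (ℕ.m≤m⊔n _ _))
                                                     (proj₂ (s⟶b δ 0<δ) n (ℕ.m≤n⊔m _ _)) ⟩
  δ ℚ.+ δ                                   ∎) (ℚ.<-irrefl refl)
  where
  open ℚ.≤-Reasoning
  open Data.Rational.Solver.+-*-Solver
  δ = ℚ.½ ℚ.* ℚ.∣ a ℚ.- b ∣
  halves : δ ℚ.+ δ ≡ ℚ.∣ a ℚ.- b ∣
  halves = trans (sym (ℚ.*-distribʳ-+ ℚ.∣ a ℚ.- b ∣ ℚ.½ ℚ.½)) (ℚ.*-identityˡ _)
  0<∣a-b∣ : 0ℚ ℚ.< ℚ.∣ a ℚ.- b ∣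
  0<∣a-b∣ = ℚ.≰⇒> λ ≤0 → a≢b (begin-equality
    a                       ≡⟨ solve 2 (λ a b → a := (a :- b) :+ b) refl a b ⟩
    (a ℚ.- b) ℚ.+ b         ≡⟨ cong (ℚ._+ b) (ℚ.∣p∣≡0⇒p≡0 (a ℚ.- b)
                                 (ℚ.≤-antisym ≤0 (ℚ.nonNegative⁻¹ _ {{ℚ.∣-∣-nonNeg (a ℚ.- b)}}))) ⟩
    0ℚ ℚ.+ b                ≡⟨ ℚ.+-identityˡ b ⟩
    b                       ∎)
  0<δ : 0ℚ ℚ.< δ
  0<δ = subst (ℚ._< δ) (ℚ.*-zeroʳ ℚ.½) (ℚ.*-monoʳ-<-pos ℚ.½ 0<∣a-b∣)
  n = proj₁ (s⟶a δ 0<δ) ℕ.⊔ proj₁ (s⟶b δ 0<δ)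

-- Mean absorption times

-- A substochastic kernel P on the states L whose defect 1 − P1 is the
-- probability of absorption, a bounded solution m of m = 1 + Pm, and the
-- probabilities f (1 + t) = Pᵗ (1 − P1) of absorption at time 1 + t.
module Absorption {A : Set} (Live : A → Set) (L : List A) (live : ∀ {l} → l ∈ L → Live l)
  (P : A → A → ℚ) (0≤P : ∀ i l → 0ℚ ℚ.≤ P i l)
  (m : A → ℚ) (μ : ℕ) (1≤m : ∀ {i} → Live i → 1ℚ ℚ.≤ m i) (m≤μ : ∀ {i} → Live i → m i ℚ.≤ ι μ)
  (mean : ∀ {i} → Live i → m i ≡ 1ℚ ℚ.+ sumOver L (λ l → P i l ℚ.* m l))
  (f : ℕ → A → ℚ)
  (f₁ : ∀ {i} → Live i → f 1 i ℚ.+ sumOver L (λ l → P i l ℚ.* 1ℚ) ≡ 1ℚ)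
  (f₂ : ∀ {i} t → Live i → f (suc (suc t)) i ≡ sumOver L (λ l → P i l ℚ.* f (suc t) l))
  where

  open Data.Rational.Solver.+-*-Solver
  open ∑ℚ
  open ℚ.≤-Reasoning

  step : (A → ℚ) → A → ℚ
  step h i = sumOver L (λ l → P i l ℚ.* h l)

  iterate : (A → ℚ) → ℕ → A → ℚ
  iterate h zero    = h
  iterate h (suc t) = step (iterate h t)

  -- With T the absorption time from i, these are P(T > t) and the expectation of `m` at the state
  -- occupied at time t, counted as 0 if T ≤ t. The second is the expected time still to run after
  -- t.
  survival tail : ℕ → A → ℚ
  survival = iterate (λ _ → 1ℚ)
  tail     = iterate m

  step-cong : ∀ {h h′} → (∀ {l} → Live l → h l ≡ h′ l) → ∀ i → step h i ≡ step h′ i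
  step-cong h≗h′ i = ∑-cong-∈ L λ l l∈ → cong (P i l ℚ.*_) (h≗h′ (live l∈))

  step-+ : ∀ h h′ i → step (λ l → h l ℚ.+ h′ l) i ≡ step h i ℚ.+ step h′ i
  step-+ h h′ i = trans (∑-cong L λ l → ℚ.*-distribˡ-+ (P i l) (h l) (h′ l))
                         (∑-+ L (λ l → P i l ℚ.* h l) (λ l → P i l ℚ.* h′ l))

  step-* : ∀ c h i → step (λ l → c ℚ.* h l) i ≡ c ℚ.* step h i
  step-* c h i = trans
    (∑-cong L λ l → solve 3 (λ p c h → p :* (c :* h) := c :* (p :* h)) refl (P i l) c (h l))
    (∑-*ˡ L c _)

  step-mono : ∀ {h h′} → (∀ {l} → Live l → h l ℚ.≤ h′ l) → ∀ i → step h i ℚ.≤ step h′ i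
  step-mono h≤h′ i = ∑ℚ-mono-≤ L λ l l∈ →
    ℚ.*-monoˡ-≤-nonNeg (P i l) {{ℚ.nonNegative (0≤P i l)}} (h≤h′ (live l∈))

  f-survival : ∀ t {i} → Live i → f (suc t) i ℚ.+ survival (suc t) i ≡ survival t i
  f-survival zero    li = f₁ li
  f-survival (suc t) {i} li = begin-equality
    f (2 ℕ.+ t) i ℚ.+ survival (2 ℕ.+ t) i         ≡⟨ cong (ℚ._+ survival (2 ℕ.+ t) i) (f₂ t li) ⟩
    step (f (suc t)) i ℚ.+ survival (2 ℕ.+ t) i    ≡⟨ step-+ (f (suc t)) (survival (suc t)) i ⟨
    step (λ l → f (suc t) l ℚ.+ survival (suc t) l) i ≡⟨ step-cong (f-survival t) i ⟩
    survival (suc t) i                             ∎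

  -- The one-step equation for `m`, pushed through t steps of the kernel.
  tail-survival : ∀ t {i} → Live i → tail t i ≡ survival t i ℚ.+ tail (suc t) i
  tail-survival zero    li = mean li
  tail-survival (suc t) {i} li =
    trans (step-cong (tail-survival t) i) (step-+ (survival t) (tail (suc t)) i)

  0≤survival : ∀ t {i} → Live i → 0ℚ ℚ.≤ survival t i
  0≤survival zero    li = subst (0ℚ ℚ.≤_) ι-1 (0≤ι 1)
  0≤survival (suc t) {i} li = subst (ℚ._≤ survival (suc t) i)
    (trans (∑-cong L λ l → ℚ.*-zeroʳ (P i l)) (∑-zero L)) (step-mono (0≤survival t) i)

  survival≤tail : ∀ t {i} → Live i → survival t i ℚ.≤ tail t i
  survival≤tail zero    li = 1≤m li
  survival≤tail (suc t) {i} li = step-mono (survival≤tail t) i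

  -- The upper bound on `m` is preserved by the kernel. Read as a lower bound on `survival`, it says
  -- through `tail-survival` that the tail loses a fixed proportion in each step.
  tail≤μ*survival : ∀ t {i} → Live i → tail t i ℚ.≤ ι μ ℚ.* survival t i
  tail≤μ*survival zero    li = subst (_ ℚ.≤_) (sym (ℚ.*-identityʳ (ι μ))) (m≤μ li)
  tail≤μ*survival (suc t) {i} li =
    subst (tail (suc t) i ℚ.≤_) (step-* (ι μ) (survival t) i) (step-mono (tail≤μ*survival t) i)

  partialMean : ℕ → A → ℚ
  partialMean n i = sumOver (upTo n) (λ t → ratio t 1 ℚ.* f t i)

  partialMean-suc : ∀ n i → partialMean (suc n) i ≡ partialMean n i ℚ.+ ι n ℚ.* f n i
  partialMean-suc n i = begin-equality
    partialMean (suc n) i                        ≡⟨ cong (λ ts → ∑ ts g) (upTo-∷ʳ n) ⟨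
    ∑ (upTo n ++ [ n ]) g                        ≡⟨ ∑-++ (upTo n) [ n ] g ⟩
    partialMean n i ℚ.+ (g n ℚ.+ 0ℚ)             ≡⟨ cong (partialMean n i ℚ.+_) (ℚ.+-identityʳ (g n)) ⟩
    partialMean n i ℚ.+ ratio n 1 ℚ.* f n i      ≡⟨ cong (λ r → partialMean n i ℚ.+ r ℚ.* f n i) (ι≡ratio n) ⟨
    partialMean n i ℚ.+ ι n ℚ.* f n i            ∎
    where
    g : ℕ → ℚ
    g t = ratio t 1 ℚ.* f t i

  -- E[T; T > n], written as n P(T > n) plus the expected time still to run after n.
  error : ℕ → A → ℚ
  error n i = tail n i ℚ.+ ι n ℚ.* survival n i

  -- Summation by parts: f (1 + n) is a difference of survival probabilities, and the survival
  -- probabilities are differences of tails.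
  mean≡partialMean+error : ∀ n {i} → Live i → m i ≡ partialMean (suc n) i ℚ.+ error n i
  mean≡partialMean+error zero {i} li = begin-equality
    m i
      ≡⟨ solve 3 (λ m f g → m := (con 0ℚ :* f :+ con 0ℚ) :+ (m :+ con 0ℚ :* g)) refl (m i) (f 0 i) 1ℚ ⟩
    (0ℚ ℚ.* f 0 i ℚ.+ 0ℚ) ℚ.+ (m i ℚ.+ 0ℚ ℚ.* 1ℚ)
      ≡⟨ cong (λ z → (0ℚ ℚ.* f 0 i ℚ.+ 0ℚ) ℚ.+ (m i ℚ.+ z ℚ.* 1ℚ)) ι-0 ⟨
    partialMean 1 i ℚ.+ error 0 i ∎
  mean≡partialMean+error (suc n) {i} li = begin-equality
    m i                                                                   ≡⟨ mean≡partialMean+error n li ⟩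
    S ℚ.+ (tail n i ℚ.+ ι n ℚ.* g)
      ≡⟨ cong₂ (λ t g → S ℚ.+ (t ℚ.+ ι n ℚ.* g)) (tail-survival n li) (sym (f-survival n li)) ⟩
    S ℚ.+ ((g ℚ.+ T′) ℚ.+ ι n ℚ.* (f′ ℚ.+ g′))
      ≡⟨ cong (λ g → S ℚ.+ ((g ℚ.+ T′) ℚ.+ ι n ℚ.* (f′ ℚ.+ g′))) (f-survival n li) ⟨
    S ℚ.+ (((f′ ℚ.+ g′) ℚ.+ T′) ℚ.+ ι n ℚ.* (f′ ℚ.+ g′))
      ≡⟨ solve 5 (λ s t f g n → s :+ (((f :+ g) :+ t) :+ n :* (f :+ g))
                  := (s :+ (con 1ℚ :+ n) :* f) :+ (t :+ (con 1ℚ :+ n) :* g)) refl S T′ f′ g′ (ι n) ⟩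
    (S ℚ.+ (1ℚ ℚ.+ ι n) ℚ.* f′) ℚ.+ (T′ ℚ.+ (1ℚ ℚ.+ ι n) ℚ.* g′)
      ≡⟨ cong (λ k → (S ℚ.+ k ℚ.* f′) ℚ.+ (T′ ℚ.+ k ℚ.* g′)) (ι-suc n) ⟨
    (S ℚ.+ ι (suc n) ℚ.* f′) ℚ.+ error (suc n) i
      ≡⟨ cong (ℚ._+ error (suc n) i) (partialMean-suc (suc n) i) ⟨
    partialMean (2 ℕ.+ n) i ℚ.+ error (suc n) i ∎
    where
    S  = partialMean (suc n) i
    g  = survival n i
    g′ = survival (suc n) i
    T′ = tail (suc n) i
    f′ = f (suc n) i

  -- tail (t + 1) ≤ (1 − 1/μ) tail t gives exponential decay, but the quadratic
  -- rate 1/((t + ℓ)(t + ℓ + 1)) suffices and avoids powers in the induction.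
  private
    ℓ : ℕ
    ℓ = suc (2 ℕ.* μ)

    bound : ℕ
    bound = ℓ ℕ.* suc ℓ ℕ.* μ

  tail-decay : ∀ n {i} → Live i → ι ((n ℕ.+ ℓ) ℕ.* suc (n ℕ.+ ℓ)) ℚ.* tail n i ℚ.≤ ι bound
  tail-decay zero {i} li = begin
    ι (ℓ ℕ.* suc ℓ) ℚ.* m i    ≤⟨ ℚ.*-monoˡ-≤-nonNeg (ι (ℓ ℕ.* suc ℓ)) {{ℚ.nonNegative (0≤ι (ℓ ℕ.* suc ℓ))}} (m≤μ li) ⟩
    ι (ℓ ℕ.* suc ℓ) ℚ.* ι μ    ≡⟨ ι-* (ℓ ℕ.* suc ℓ) μ ⟨
    ι bound                    ∎
  tail-decay (suc n) {i} li = begin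
    ι (suc a ℕ.* (2 ℕ.+ a)) ℚ.* T′           ≡⟨ cong (ℚ._* T′) (ι-* (suc a) (2 ℕ.+ a)) ⟩
    ι (suc a) ℚ.* ι (2 ℕ.+ a) ℚ.* T′         ≡⟨ ℚ.*-assoc (ι (suc a)) _ _ ⟩
    ι (suc a) ℚ.* (ι (2 ℕ.+ a) ℚ.* T′)       ≤⟨ ℚ.*-monoˡ-≤-nonNeg (ι (suc a)) {{ℚ.nonNegative (0≤ι (suc a))}} key ⟩
    ι (suc a) ℚ.* (ι a ℚ.* T)                ≡⟨ solve 3 (λ s a t → s :* (a :* t) := a :* s :* t) refl (ι (suc a)) (ι a) T ⟩
    ι a ℚ.* ι (suc a) ℚ.* T                  ≡⟨ cong (ℚ._* T) (ι-* a (suc a)) ⟨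
    ι (a ℕ.* suc a) ℚ.* T                    ≤⟨ tail-decay n li ⟩
    ι bound                                  ∎
    where
    a  = n ℕ.+ ℓ
    T  = tail n i
    T′ = tail (suc n) i
    g  = survival n i
    -- The choice of `ℓ` enters here: 2 μ ≤ 2 + a, so the loss `g` is at least the fraction 2/(2 +
    -- a) of the tail. Hence (2 + a) T′ ≤ a T, exactly what is needed when the weight a (1 + a)
    -- grows to (1 + a) (2 + a).
    2T≤ : ι 2 ℚ.* T ℚ.≤ ι (2 ℕ.+ a) ℚ.* g
    2T≤ = begin
      ι 2 ℚ.* T               ≤⟨ ℚ.*-monoˡ-≤-nonNeg (ι 2) {{ℚ.nonNegative (0≤ι 2)}} (tail≤μ*survival n li) ⟩
      ι 2 ℚ.* (ι μ ℚ.* g)     ≡⟨ ℚ.*-assoc (ι 2) (ι μ) g ⟨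
      ι 2 ℚ.* ι μ ℚ.* g       ≡⟨ cong (ℚ._* g) (ι-* 2 μ) ⟨
      ι (2 ℕ.* μ) ℚ.* g       ≤⟨ ℚ.*-monoʳ-≤-nonNeg g {{ℚ.nonNegative (0≤survival n li)}}
                                   (ι-mono-≤ (ℕ.m≤n⇒m≤o+n 2 (ℕ.m≤n⇒m≤o+n n (ℕ.n≤1+n _)))) ⟩
      ι (2 ℕ.+ a) ℚ.* g       ∎
    key : ι (2 ℕ.+ a) ℚ.* T′ ℚ.≤ ι a ℚ.* T
    key = begin
      ι (2 ℕ.+ a) ℚ.* T′
        ≡⟨ solve 3 (λ k t g → k :* t := k :* (g :+ t) :- k :* g) refl (ι (2 ℕ.+ a)) T′ g ⟩
      ι (2 ℕ.+ a) ℚ.* (g ℚ.+ T′) ℚ.- ι (2 ℕ.+ a) ℚ.* g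
        ≡⟨ cong₂ (λ k t → k ℚ.* t ℚ.- ι (2 ℕ.+ a) ℚ.* g) (ι-+ 2 a) (sym (tail-survival n li)) ⟩
      (ι 2 ℚ.+ ι a) ℚ.* T ℚ.- ι (2 ℕ.+ a) ℚ.* g
        ≡⟨ solve 4 (λ two a t k → (two :+ a) :* t :- k := two :* t :+ (a :* t :- k)) refl (ι 2) (ι a) T (ι (2 ℕ.+ a) ℚ.* g) ⟩
      ι 2 ℚ.* T ℚ.+ (ι a ℚ.* T ℚ.- ι (2 ℕ.+ a) ℚ.* g)
        ≤⟨ ℚ.+-monoˡ-≤ _ 2T≤ ⟩
      ι (2 ℕ.+ a) ℚ.* g ℚ.+ (ι a ℚ.* T ℚ.- ι (2 ℕ.+ a) ℚ.* g)
        ≡⟨ solve 2 (λ k t → k :+ (t :- k) := t) refl (ι (2 ℕ.+ a) ℚ.* g) (ι a ℚ.* T) ⟩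
      ι a ℚ.* T ∎

  0≤error : ∀ n {i} → Live i → 0ℚ ℚ.≤ error n i
  0≤error n li = ℚ.+-mono-≤ (ℚ.≤-trans (0≤survival n li) (survival≤tail n li))
                            (0≤* (0≤ι n) (0≤survival n li))

  -- By `survival≤tail` the error is at most (1 + n) times the tail, so quadratic decay of the tail
  -- leaves decay of order 1/(1 + n).
  error-decay : ∀ n {i} → Live i → ι (suc n) ℚ.* error n i ℚ.≤ ι bound
  error-decay n {i} li = begin
    ι (suc n) ℚ.* (T ℚ.+ ι n ℚ.* g)            ≤⟨ mono (suc n) (ℚ.+-monoʳ-≤ T (mono n (survival≤tail n li))) ⟩
    ι (suc n) ℚ.* (T ℚ.+ ι n ℚ.* T)            ≡⟨ cong (λ t → ι (suc n) ℚ.* (t ℚ.+ ι n ℚ.* T)) (ℚ.*-identityˡ T) ⟨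
    ι (suc n) ℚ.* (1ℚ ℚ.* T ℚ.+ ι n ℚ.* T)     ≡⟨ cong (ι (suc n) ℚ.*_) (ℚ.*-distribʳ-+ T 1ℚ (ι n)) ⟨
    ι (suc n) ℚ.* ((1ℚ ℚ.+ ι n) ℚ.* T)         ≡⟨ cong (λ k → ι (suc n) ℚ.* (k ℚ.* T)) (ι-suc n) ⟨
    ι (suc n) ℚ.* (ι (suc n) ℚ.* T)            ≡⟨ ℚ.*-assoc (ι (suc n)) (ι (suc n)) T ⟨
    ι (suc n) ℚ.* ι (suc n) ℚ.* T              ≡⟨ cong (ℚ._* T) (ι-* (suc n) (suc n)) ⟨
    ι (suc n ℕ.* suc n) ℚ.* T                  ≤⟨ ℚ.*-monoʳ-≤-nonNeg T {{ℚ.nonNegative 0≤T}} (ι-mono-≤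
                                                    (ℕ.*-mono-≤ 1+n≤ (ℕ.m≤n⇒m≤1+n 1+n≤))) ⟩
    ι ((n ℕ.+ ℓ) ℕ.* suc (n ℕ.+ ℓ)) ℚ.* T      ≤⟨ tail-decay n li ⟩
    ι bound                                    ∎
    where
    T = tail n i
    g = survival n i
    mono : ∀ k {p q} → p ℚ.≤ q → ι k ℚ.* p ℚ.≤ ι k ℚ.* q
    mono k = ℚ.*-monoˡ-≤-nonNeg (ι k) {{ℚ.nonNegative (0≤ι k)}}
    0≤T : 0ℚ ℚ.≤ T
    0≤T = ℚ.≤-trans (0≤survival n li) (survival≤tail n li)
    1+n≤ : suc n ℕ.≤ n ℕ.+ ℓ
    1+n≤ = ℕ.≤-trans (ℕ.≤-reflexive (ℕ.+-comm 1 n)) (ℕ.+-monoʳ-≤ n (s≤s z≤n))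

  partialMean⟶mean : ∀ {i} → Live i → (λ n → partialMean n i) ⟶ m i
  partialMean⟶mean {i} li η 0<η with archimedean bound 0<η
  ... | N , bound< = suc N , λ where
    (suc n) (s≤s N≤n) → begin-strict
      ℚ.∣ partialMean (suc n) i ℚ.- m i ∣
        ≡⟨ ∣p-q∣≡∣q-p∣ (partialMean (suc n) i) (m i) ⟩
      ℚ.∣ m i ℚ.- partialMean (suc n) i ∣
        ≡⟨ cong (λ k → ℚ.∣ k ℚ.- partialMean (suc n) i ∣) (mean≡partialMean+error n li) ⟩
      ℚ.∣ partialMean (suc n) i ℚ.+ error n i ℚ.- partialMean (suc n) i ∣
        ≡⟨ cong ℚ.∣_∣ (solve 2 (λ s e → s :+ e :- s := e) refl (partialMean (suc n) i) (error n i)) ⟩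
      ℚ.∣ error n i ∣
        ≡⟨ ℚ.0≤p⇒∣p∣≡p (0≤error n li) ⟩
      error n i
        <⟨ ℚ.*-cancelˡ-<-nonNeg (ι (suc N)) {{ℚ.nonNegative (0≤ι (suc N))}} (begin-strict
             ι (suc N) ℚ.* error n i  ≤⟨ ℚ.*-monoʳ-≤-nonNeg (error n i) {{ℚ.nonNegative (0≤error n li)}}
                                           (ι-mono-≤ (s≤s N≤n)) ⟩
             ι (suc n) ℚ.* error n i  ≤⟨ error-decay n li ⟩
             ι bound                  <⟨ bound< ⟩
             ι (suc N) ℚ.* η          ∎) ⟩
      η ∎

-- Tree metrics

-- The shape in which the tree property enters: towards any z, every x ≢ z has
-- exactly one neighbour that is closer to z, and all others are farther.
record TreeMetric {V : FinSet} (H : Graph V) : Set where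
  open Graph H
  field
    d             : Carrier V → Carrier V → ℕ
    d-refl        : ∀ z → d z z ≡ 0
    d-step        : ∀ {x y} → Adj x y → ∀ z → d x z ≡ suc (d y z) ⊎ d y z ≡ suc (d x z)
    parent        : ∀ {x z} → x ≢ z → ∃[ p ] (Adj x p × d x z ≡ suc (d p z))
    parent-unique : ∀ {x y y′ z} → Adj x y → Adj x y′ →
                    d x z ≡ suc (d y z) → d x z ≡ suc (d y′ z) → y ≡ y′

module TreeMetricProperties {V : FinSet} {H : Graph V} (T : TreeMetric H) where
  open FinSet V using (_≟_; complete; unique)
  open Graph H
  open TreeMetric T public

  d≡0⇒≡ : ∀ {x z} → d x z ≡ 0 → x ≡ z
  d≡0⇒≡ {x} {z} d≡0 with x ≟ z
  ... | yes x≡z = x≡z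
  ... | no  x≢z with parent x≢z
  ... | _ , _ , d≡suc with () ← trans (sym d≡0) d≡suc

  d≡suc⇒≢ : ∀ {x z m} → d x z ≡ suc m → x ≢ z
  d≡suc⇒≢ {x} d≡ refl with () ← trans (sym d≡) (d-refl x)

  d-step-≤ : ∀ {x y} → Adj x y → ∀ z → d x z ℕ.≤ suc (d y z)
  d-step-≤ a z with d-step a z
  ... | inj₁ e = ℕ.≤-reflexive e
  ... | inj₂ e = ℕ.≤-trans (ℕ.n≤1+n _) (ℕ.≤-trans (ℕ.≤-reflexive (sym e)) (ℕ.n≤1+n _))

  -- Induction along a geodesic from x to y, each edge of which changes the distance to z by at most
  -- one.
  triangle : ∀ {x y} z n → d x y ≡ n → d x z ℕ.≤ n ℕ.+ d y z
  triangle {x} {y} z zero    e = ℕ.≤-reflexive (cong (λ w → d w z) (d≡0⇒≡ e))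
  triangle {x} {y} z (suc n) e with parent (d≡suc⇒≢ e)
  ... | p , a , e′ = ℕ.≤-trans (d-step-≤ a z) (s≤s (triangle z n (ℕ.suc-injective (trans (sym e′) e))))

  private
    Reaches : ℕ → Carrier V → Carrier V → Set
    Reaches zero    x z = x ≡ z
    Reaches (suc n) x z = ∃[ y ] (Adj x y × Reaches n y z)

    snoc : ∀ n {x y z} → Reaches n x y → Adj y z → Reaches (suc n) x z
    snoc zero    refl        b = _ , b , refl
    snoc (suc n) (_ , a , r) b = _ , a , snoc n r b

    reverse : ∀ n {x z} → Reaches n x z → Reaches n z x
    reverse zero    refl        = refl
    reverse (suc n) (_ , a , r) = snoc n (reverse n r) (adj-sym a)

    geodesic : ∀ n {x z} → d x z ≡ n → Reaches n x z
    geodesic zero    e = d≡0⇒≡ e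
    geodesic (suc n) e with parent (d≡suc⇒≢ e)
    ... | p , a , e′ = p , a , geodesic n (ℕ.suc-injective (trans (sym e′) e))

    d≤ : ∀ n {x z} → Reaches n x z → d x z ℕ.≤ n
    d≤ zero    {x} refl   = ℕ.≤-reflexive (d-refl x)
    d≤ (suc n) (_ , a , r) = ℕ.≤-trans (d-step-≤ a _) (s≤s (d≤ n r))

  -- d x z is the least n with `Reaches n x z`, and walks can be reversed.
  d-sym : ∀ x z → d x z ≡ d z x
  d-sym x z = ℕ.≤-antisym (d≤ _ (reverse _ (geodesic _ refl))) (d≤ _ (reverse _ (geodesic _ refl)))

  adj⇒d≡1 : ∀ {x y} → Adj x y → d x y ≡ 1
  adj⇒d≡1 {x} {y} a with d-step a y
  ... | inj₁ e = trans e (cong suc (d-refl y))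
  ... | inj₂ e with () ← trans (sym (d-refl y)) e

  transmission : Carrier V → ℕ
  transmission x = ∑ℕ.∑ (elements V) (d x)

  -- Taken over ordered pairs, hence twice the classical Wiener index.
  wiener : ℕ
  wiener = ∑ℕ.∑ (elements V) transmission

-- Kemeny's constant of a tree

-- Links `edgeCount`, which counts unordered pairs, with the degrees, which count ordered ones.
∑-pairs : (xs : List A) (a : A → A → ℕ) → (∀ x → a x x ≡ 0) → (∀ x y → a x y ≡ a y x) →
          ∑ℕ.∑ xs (λ x → ∑ℕ.∑ xs (a x)) ≡ 2 ℕ.* ∑ℕ.∑ (pairs xs) (uncurry a)
∑-pairs []       a a-irrefl a-sym = refl
∑-pairs (x ∷ xs) a a-irrefl a-sym = begin
  (a x x ℕ.+ r) ℕ.+ ∑ xs (λ y → a y x ℕ.+ ∑ xs (a y))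
    ≡⟨ cong₂ (λ i s → (i ℕ.+ r) ℕ.+ s) (a-irrefl x) (∑-+ xs (λ y → a y x) (λ y → ∑ xs (a y))) ⟩
  r ℕ.+ (∑ xs (λ y → a y x) ℕ.+ ∑ xs (λ y → ∑ xs (a y)))
    ≡⟨ cong₂ (λ s t → r ℕ.+ (s ℕ.+ t)) (∑-cong xs (λ y → a-sym y x)) (∑-pairs xs a a-irrefl a-sym) ⟩
  r ℕ.+ (r ℕ.+ 2 ℕ.* p)
    ≡⟨ ℕ.+-assoc r r (2 ℕ.* p) ⟨
  (r ℕ.+ r) ℕ.+ 2 ℕ.* p
    ≡⟨ cong (λ s → (r ℕ.+ s) ℕ.+ 2 ℕ.* p) (ℕ.+-identityʳ r) ⟨
  2 ℕ.* r ℕ.+ 2 ℕ.* p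
    ≡⟨ ℕ.*-distribˡ-+ 2 r p ⟨
  2 ℕ.* (r ℕ.+ p)
    ≡⟨ cong (λ s → 2 ℕ.* (s ℕ.+ p)) (∑-map (x ,_) xs (uncurry a)) ⟨
  2 ℕ.* (∑ (map (x ,_) xs) (uncurry a) ℕ.+ p)
    ≡⟨ cong (2 ℕ.*_) (∑-++ (map (x ,_) xs) (pairs xs) (uncurry a)) ⟨
  2 ℕ.* ∑ (pairs (x ∷ xs)) (uncurry a) ∎
  where
  open ∑ℕ
  open ≡-Reasoning
  r = ∑ xs (a x)
  p = ∑ (pairs xs) (uncurry a)

handshake : {V : FinSet} (H : Graph V) → ∑ℕ.∑ (elements V) (degree H) ≡ 2 ℕ.* edgeCount H
handshake {V} H = begin
  ∑ℕ.∑ E (degree H)                          ≡⟨ ∑ℕ.∑-cong E (λ x → ∑ℕ-𝟙 (adj? x) E) ⟨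
  ∑ℕ.∑ E (λ x → ∑ℕ.∑ E (λ y → ∑ℕ.𝟙 (adj? x y)))
    ≡⟨ ∑-pairs E (λ x y → ∑ℕ.𝟙 (adj? x y)) (λ x → ∑ℕ.𝟙-no (adj? x x) (adj-irrefl refl))
         (λ x y → ∑ℕ.𝟙-cong (adj? x y) (adj? y x) adj-sym adj-sym) ⟩
  2 ℕ.* ∑ℕ.∑ (pairs E) (λ p → ∑ℕ.𝟙 (uncurry adj? p)) ≡⟨ cong (2 ℕ.*_) (∑ℕ-𝟙 (uncurry adj?) (pairs E)) ⟩
  2 ℕ.* edgeCount H ∎
  where
  open Graph H
  open ≡-Reasoning
  E = elements V

module TreeKemeny {V : FinSet} {H : Graph V} (T : TreeMetric H) where
  open FinSet V using (_≟_; complete; unique)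
  open Graph H
  open TreeMetricProperties T
  open ∑ℚ
  open Data.Rational.Solver.+-*-Solver

  private
    C : Set
    C = Carrier V

    E : List C
    E = elements V

    e 𝔸 : C → C → ℚ
    e x y = ι (d x y)
    𝔸 x y = 𝟙 (adj? x y)

    deg D : C → ℚ
    deg x = ι (degree H x)
    D x   = ι (transmission x)

    N 2ℚ : ℚ
    N  = ι (size V)
    2ℚ = 1ℚ ℚ.+ 1ℚ

    ι-2+ : ∀ m → ι (2 ℕ.+ m) ≡ 1ℚ ℚ.+ (1ℚ ℚ.+ ι m)
    ι-2+ m = trans (ι-suc (suc m)) (cong (1ℚ ℚ.+_) (ι-suc m))

    D≡∑ : ∀ x → D x ≡ ∑ E (e x)
    D≡∑ x = ι-∑ E (d x)

    deg≡∑ : ∀ x → deg x ≡ ∑ E (𝔸 x)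
    deg≡∑ x = trans (cong ι (sym (∑ℕ-𝟙 (adj? x) E)))
                    (trans (ι-∑ E _) (∑-cong E (λ y → ι-𝟙 (adj? x y))))

    A-sym : ∀ x y → 𝔸 x y ≡ 𝔸 y x
    A-sym x y = 𝟙-cong (adj? x y) (adj? y x) adj-sym adj-sym

    ∑A-const : ∀ x c → ∑ E (λ l → 𝔸 x l ℚ.* c) ≡ deg x ℚ.* c
    ∑A-const x c = begin
      ∑ E (λ l → 𝔸 x l ℚ.* c)  ≡⟨ ∑-cong E (λ l → ℚ.*-comm (𝔸 x l) c) ⟩
      ∑ E (λ l → c ℚ.* 𝔸 x l)  ≡⟨ ∑-*ˡ E c (𝔸 x) ⟩
      c ℚ.* ∑ E (𝔸 x)          ≡⟨ cong (c ℚ.*_) (deg≡∑ x) ⟨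
      c ℚ.* deg x              ≡⟨ ℚ.*-comm c (deg x) ⟩
      deg x ℚ.* c              ∎
      where open ≡-Reasoning

    ∑∑A : ∀ (g : C → ℚ) → ∑ E (λ x → ∑ E (λ l → 𝔸 x l ℚ.* g l)) ≡ ∑ E (λ l → deg l ℚ.* g l)
    ∑∑A g = begin
      ∑ E (λ x → ∑ E (λ l → 𝔸 x l ℚ.* g l))  ≡⟨ ∑-swap E E (λ x l → 𝔸 x l ℚ.* g l) ⟩
      ∑ E (λ l → ∑ E (λ x → 𝔸 x l ℚ.* g l))  ≡⟨ ∑-cong E (λ l → ∑-cong E (λ x → cong (ℚ._* g l) (A-sym x l))) ⟩
      ∑ E (λ l → ∑ E (λ x → 𝔸 l x ℚ.* g l))  ≡⟨ ∑-cong E (λ l → ∑A-const l (g l)) ⟩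
      ∑ E (λ l → deg l ℚ.* g l)              ∎
      where open ≡-Reasoning

  -- The Laplacian of the distance, and degree sums

  module _ (φ : ℕ → ℚ) where
    -- One neighbour of x, the parent, is at distance m from z and all others are at distance 2 + m.
    -- Adding φ (2 + m) on the left avoids the number deg x - 1 of the others. The cases of interest
    -- are the identity and the square.
    neighbour-sum : ∀ {x z m} → d x z ≡ suc m →
      ∑ E (λ l → 𝔸 x l ℚ.* φ (d l z)) ℚ.+ φ (2 ℕ.+ m) ≡ deg x ℚ.* φ (2 ℕ.+ m) ℚ.+ φ m
    neighbour-sum {x} {z} {m} dxz with parent (d≡suc⇒≢ dxz)
    ... | p , x~p , dxz≡ = begin
      ∑ E (λ l → 𝔸 x l ℚ.* φ (d l z)) ℚ.+ φ (2 ℕ.+ m)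
        ≡⟨ cong (∑ E (λ l → 𝔸 x l ℚ.* φ (d l z)) ℚ.+_) (∑-point _≟_ E unique (complete p) (λ _ → φ (2 ℕ.+ m))) ⟨
      ∑ E (λ l → 𝔸 x l ℚ.* φ (d l z)) ℚ.+ ∑ E (λ l → 𝟙 (l ≟ p) ℚ.* φ (2 ℕ.+ m))
        ≡⟨ ∑-+ E (λ l → 𝔸 x l ℚ.* φ (d l z)) (λ l → 𝟙 (l ≟ p) ℚ.* φ (2 ℕ.+ m)) ⟨
      ∑ E (λ l → 𝔸 x l ℚ.* φ (d l z) ℚ.+ 𝟙 (l ≟ p) ℚ.* φ (2 ℕ.+ m))
        ≡⟨ ∑-cong E pointwise ⟩
      ∑ E (λ l → 𝔸 x l ℚ.* φ (2 ℕ.+ m) ℚ.+ 𝟙 (l ≟ p) ℚ.* φ m)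
        ≡⟨ ∑-+ E (λ l → 𝔸 x l ℚ.* φ (2 ℕ.+ m)) (λ l → 𝟙 (l ≟ p) ℚ.* φ m) ⟩
      ∑ E (λ l → 𝔸 x l ℚ.* φ (2 ℕ.+ m)) ℚ.+ ∑ E (λ l → 𝟙 (l ≟ p) ℚ.* φ m)
        ≡⟨ cong₂ ℚ._+_ (∑A-const x (φ (2 ℕ.+ m))) (∑-point _≟_ E unique (complete p) (λ _ → φ m)) ⟩
      deg x ℚ.* φ (2 ℕ.+ m) ℚ.+ φ m ∎
      where
      open ≡-Reasoning
      pointwise : ∀ l → 𝔸 x l ℚ.* φ (d l z) ℚ.+ 𝟙 (l ≟ p) ℚ.* φ (2 ℕ.+ m)
                      ≡ 𝔸 x l ℚ.* φ (2 ℕ.+ m) ℚ.+ 𝟙 (l ≟ p) ℚ.* φ m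
      pointwise l with l ≟ p | adj? x l
      ... | yes refl | yes _  = trans
        (cong (λ k → 1ℚ ℚ.* φ k ℚ.+ 1ℚ ℚ.* φ (2 ℕ.+ m)) (ℕ.suc-injective (trans (sym dxz≡) dxz)))
        (ℚ.+-comm (1ℚ ℚ.* φ m) (1ℚ ℚ.* φ (2 ℕ.+ m)))
      ... | yes refl | no ¬a  = contradiction x~p ¬a
      ... | no l≢p   | no _   = solve 3 (λ a b c → con 0ℚ :* a :+ con 0ℚ :* b := con 0ℚ :* b :+ con 0ℚ :* c) refl
                                  (φ (d l z)) (φ (2 ℕ.+ m)) (φ m)
      ... | no l≢p   | yes a with d-step a z
      ...   | inj₁ closer = contradiction (parent-unique a x~p closer dxz≡) l≢p
      ...   | inj₂ dlz    = cong₂ ℚ._+_ (cong (λ k → 1ℚ ℚ.* φ k) (trans dlz (cong suc dxz)))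
                              (trans (ℚ.*-zeroˡ (φ (2 ℕ.+ m))) (sym (ℚ.*-zeroˡ (φ m))))

    neighbour-sum-self : ∀ z → ∑ E (λ l → 𝔸 z l ℚ.* φ (d l z)) ≡ deg z ℚ.* φ 1
    neighbour-sum-self z = trans (∑-cong E pointwise) (∑A-const z (φ 1))
      where
      pointwise : ∀ l → 𝔸 z l ℚ.* φ (d l z) ≡ 𝔸 z l ℚ.* φ 1
      pointwise l with adj? z l
      ... | yes a = cong (λ k → 1ℚ ℚ.* φ k) (adj⇒d≡1 (adj-sym a))
      ... | no _  = trans (ℚ.*-zeroˡ (φ (d l z))) (sym (ℚ.*-zeroˡ (φ 1)))

  -- Away from z the parent contributes 2 less than the other neighbours. At z itself there is no
  -- parent, which the indicator term makes up for.
  laplacian-d : ∀ x z → ∑ E (λ l → 𝔸 x l ℚ.* e l z) ℚ.+ 2ℚ ≡ deg x ℚ.* (e x z ℚ.+ 1ℚ) ℚ.+ 𝟙 (x ≟ z) ℚ.* 2ℚ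
  laplacian-d x z with d x z in dxz
  ... | zero with refl ← d≡0⇒≡ dxz = begin
    S ℚ.+ 2ℚ                                       ≡⟨ cong (ℚ._+ 2ℚ) (neighbour-sum-self ι x) ⟩
    deg x ℚ.* ι 1 ℚ.+ 2ℚ                           ≡⟨ cong₂ (λ a b → deg x ℚ.* a ℚ.+ b ℚ.* 2ℚ) (trans (ι-suc 0) (ℚ.+-comm 1ℚ (ι 0))) (sym (𝟙-yes (x ≟ x) refl)) ⟩
    deg x ℚ.* (ι 0 ℚ.+ 1ℚ) ℚ.+ 𝟙 (x ≟ x) ℚ.* 2ℚ    ∎
    where
    open ≡-Reasoning
    S = ∑ E (λ l → 𝔸 x l ℚ.* e l z)
  ... | suc m = begin
    S ℚ.+ 2ℚ
      ≡⟨ solve 2 (λ s m → s :+ con 2ℚ := (s :+ (con 1ℚ :+ (con 1ℚ :+ m))) :- m) refl S (ι m) ⟩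
    S ℚ.+ (1ℚ ℚ.+ (1ℚ ℚ.+ ι m)) ℚ.- ι m
      ≡⟨ cong (λ k → S ℚ.+ k ℚ.- ι m) (ι-2+ m) ⟨
    S ℚ.+ ι (2 ℕ.+ m) ℚ.- ι m
      ≡⟨ cong (ℚ._- ι m) (neighbour-sum ι dxz) ⟩
    deg x ℚ.* ι (2 ℕ.+ m) ℚ.+ ι m ℚ.- ι m
      ≡⟨ cong (λ k → deg x ℚ.* k ℚ.+ ι m ℚ.- ι m) (ι-2+ m) ⟩
    deg x ℚ.* (1ℚ ℚ.+ (1ℚ ℚ.+ ι m)) ℚ.+ ι m ℚ.- ι m
      ≡⟨ solve 2 (λ g m → g :* (con 1ℚ :+ (con 1ℚ :+ m)) :+ m :- m
                        := g :* ((con 1ℚ :+ m) :+ con 1ℚ) :+ con 0ℚ :* con 2ℚ) refl (deg x) (ι m) ⟩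
    deg x ℚ.* ((1ℚ ℚ.+ ι m) ℚ.+ 1ℚ) ℚ.+ 0ℚ ℚ.* 2ℚ
      ≡⟨ cong₂ (λ a b → deg x ℚ.* (a ℚ.+ 1ℚ) ℚ.+ b ℚ.* 2ℚ) (ι-suc m) (𝟙-no (x ≟ z) (d≡suc⇒≢ dxz)) ⟨
    deg x ℚ.* (ι (suc m) ℚ.+ 1ℚ) ℚ.+ 𝟙 (x ≟ z) ℚ.* 2ℚ ∎
    where
    open ≡-Reasoning
    S = ∑ E (λ l → 𝔸 x l ℚ.* e l z)

  -- At distance k the parent contributes (k + 1)² - (k - 1)² = 4 k less than the other neighbours.
  -- This vanishes at k = 0, so x = z obeys the same formula.
  laplacian-d² : ∀ x z → ∑ E (λ l → 𝔸 x l ℚ.* (e l z ℚ.* e l z)) ℚ.+ (2ℚ ℚ.+ 2ℚ) ℚ.* e x z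
                       ≡ deg x ℚ.* ((e x z ℚ.+ 1ℚ) ℚ.* (e x z ℚ.+ 1ℚ))
  laplacian-d² x z with d x z in dxz
  ... | zero with refl ← d≡0⇒≡ dxz = begin
    S ℚ.+ (2ℚ ℚ.+ 2ℚ) ℚ.* ι 0
      ≡⟨ cong₂ (λ s o → s ℚ.+ (2ℚ ℚ.+ 2ℚ) ℚ.* o) (neighbour-sum-self (λ n → ι n ℚ.* ι n) x) ι-0 ⟩
    deg x ℚ.* (ι 1 ℚ.* ι 1) ℚ.+ (2ℚ ℚ.+ 2ℚ) ℚ.* 0ℚ
      ≡⟨ cong (λ o → deg x ℚ.* (o ℚ.* o) ℚ.+ (2ℚ ℚ.+ 2ℚ) ℚ.* 0ℚ) ι-1 ⟩
    deg x ℚ.* (1ℚ ℚ.* 1ℚ) ℚ.+ (2ℚ ℚ.+ 2ℚ) ℚ.* 0ℚ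
      ≡⟨ solve 1 (λ g → g :* (con 1ℚ :* con 1ℚ) :+ (con 2ℚ :+ con 2ℚ) :* con 0ℚ
                     := g :* ((con 0ℚ :+ con 1ℚ) :* (con 0ℚ :+ con 1ℚ))) refl (deg x) ⟩
    deg x ℚ.* ((0ℚ ℚ.+ 1ℚ) ℚ.* (0ℚ ℚ.+ 1ℚ))
      ≡⟨ cong (λ o → deg x ℚ.* ((o ℚ.+ 1ℚ) ℚ.* (o ℚ.+ 1ℚ))) ι-0 ⟨
    deg x ℚ.* ((ι 0 ℚ.+ 1ℚ) ℚ.* (ι 0 ℚ.+ 1ℚ)) ∎
    where
    open ≡-Reasoning
    S = ∑ E (λ l → 𝔸 x l ℚ.* (e l z ℚ.* e l z))
  ... | suc m = begin
    S ℚ.+ (2ℚ ℚ.+ 2ℚ) ℚ.* ι (suc m)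
      ≡⟨ cong (λ k → S ℚ.+ (2ℚ ℚ.+ 2ℚ) ℚ.* k) (ι-suc m) ⟩
    S ℚ.+ (2ℚ ℚ.+ 2ℚ) ℚ.* (1ℚ ℚ.+ ι m)
      ≡⟨ solve 2 (λ s m → s :+ (con 2ℚ :+ con 2ℚ) :* (con 1ℚ :+ m)
                       := (s :+ (con 1ℚ :+ (con 1ℚ :+ m)) :* (con 1ℚ :+ (con 1ℚ :+ m))) :- m :* m) refl S (ι m) ⟩
    S ℚ.+ (1ℚ ℚ.+ (1ℚ ℚ.+ ι m)) ℚ.* (1ℚ ℚ.+ (1ℚ ℚ.+ ι m)) ℚ.- ι m ℚ.* ι m
      ≡⟨ cong (λ k → S ℚ.+ k ℚ.* k ℚ.- ι m ℚ.* ι m) (ι-2+ m) ⟨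
    S ℚ.+ ι (2 ℕ.+ m) ℚ.* ι (2 ℕ.+ m) ℚ.- ι m ℚ.* ι m
      ≡⟨ cong (ℚ._- ι m ℚ.* ι m) (neighbour-sum (λ n → ι n ℚ.* ι n) dxz) ⟩
    deg x ℚ.* (ι (2 ℕ.+ m) ℚ.* ι (2 ℕ.+ m)) ℚ.+ ι m ℚ.* ι m ℚ.- ι m ℚ.* ι m
      ≡⟨ cong (λ k → deg x ℚ.* (k ℚ.* k) ℚ.+ ι m ℚ.* ι m ℚ.- ι m ℚ.* ι m) (ι-2+ m) ⟩
    deg x ℚ.* ((1ℚ ℚ.+ (1ℚ ℚ.+ ι m)) ℚ.* (1ℚ ℚ.+ (1ℚ ℚ.+ ι m))) ℚ.+ ι m ℚ.* ι m ℚ.- ι m ℚ.* ι m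
      ≡⟨ solve 2 (λ g m → g :* ((con 1ℚ :+ (con 1ℚ :+ m)) :* (con 1ℚ :+ (con 1ℚ :+ m))) :+ m :* m :- m :* m
                       := g :* (((con 1ℚ :+ m) :+ con 1ℚ) :* ((con 1ℚ :+ m) :+ con 1ℚ))) refl (deg x) (ι m) ⟩
    deg x ℚ.* (((1ℚ ℚ.+ ι m) ℚ.+ 1ℚ) ℚ.* ((1ℚ ℚ.+ ι m) ℚ.+ 1ℚ))
      ≡⟨ cong (λ a → deg x ℚ.* ((a ℚ.+ 1ℚ) ℚ.* (a ℚ.+ 1ℚ))) (ι-suc m) ⟨
    deg x ℚ.* ((ι (suc m) ℚ.+ 1ℚ) ℚ.* (ι (suc m) ℚ.+ 1ℚ)) ∎
    where
    open ≡-Reasoning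
    S = ∑ E (λ l → 𝔸 x l ℚ.* (e l z ℚ.* e l z))

  -- Summing `laplacian-d` over x: by symmetry of adjacency the degree-weighted distances appear on
  -- both sides and cancel. The result says that there are n - 1 edges.
  sum-degrees : C → ∑ E deg ℚ.+ 2ℚ ≡ N ℚ.* 2ℚ
  sum-degrees z = begin
    G ℚ.+ 2ℚ
      ≡⟨ solve 3 (λ f g t → g :+ t := ((f :+ g) :+ t) :- f) refl F G 2ℚ ⟩
    (F ℚ.+ G) ℚ.+ 2ℚ ℚ.- F
      ≡⟨ cong (ℚ._- F) (trans (sym rhs) (trans (sym (∑-cong E (λ x → laplacian-d x z))) lhs)) ⟩
    (F ℚ.+ N ℚ.* 2ℚ) ℚ.- F
      ≡⟨ solve 2 (λ f t → (f :+ t) :- f := t) refl F (N ℚ.* 2ℚ) ⟩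
    N ℚ.* 2ℚ ∎
    where
    open ≡-Reasoning
    G = ∑ E deg
    F = ∑ E (λ x → deg x ℚ.* e x z)
    lhs : ∑ E (λ x → ∑ E (λ l → 𝔸 x l ℚ.* e l z) ℚ.+ 2ℚ) ≡ F ℚ.+ N ℚ.* 2ℚ
    lhs = trans (∑-+ E (λ x → ∑ E (λ l → 𝔸 x l ℚ.* e l z)) (λ _ → 2ℚ))
                (cong₂ ℚ._+_ (∑∑A (λ l → e l z)) (∑ℚ-const E 2ℚ))
    rhs : ∑ E (λ x → deg x ℚ.* (e x z ℚ.+ 1ℚ) ℚ.+ 𝟙 (x ≟ z) ℚ.* 2ℚ) ≡ (F ℚ.+ G) ℚ.+ 2ℚ
    rhs = trans (∑-+ E (λ x → deg x ℚ.* (e x z ℚ.+ 1ℚ)) (λ x → 𝟙 (x ≟ z) ℚ.* 2ℚ))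
      (cong₂ ℚ._+_
        (trans (∑-cong E (λ x → solve 2 (λ g e → g :* (e :+ con 1ℚ) := g :* e :+ g) refl (deg x) (e x z)))
               (∑-+ E (λ x → deg x ℚ.* e x z) deg))
        (∑-point _≟_ E unique (complete z) (λ _ → 2ℚ)))

  -- The same double count for `laplacian-d²`: now the degree-weighted squares cancel, and twice the
  -- degree-weighted distances remain, whence the factor ½.
  sum-degree-distances : ∀ z → ∑ E (λ x → deg x ℚ.* e x z) ℚ.+ (N ℚ.- 1ℚ) ≡ 2ℚ ℚ.* D z
  sum-degree-distances z = begin
    F ℚ.+ (N ℚ.- 1ℚ)
      ≡⟨ solve 3 (λ f n f₂ → f :+ (n :- con 1ℚ)
           := con ℚ.½ :* ((f₂ :+ (con 2ℚ :* f :+ (n :* con 2ℚ :- con 2ℚ))) :- f₂)) refl F N F₂ ⟩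
    ℚ.½ ℚ.* ((F₂ ℚ.+ (2ℚ ℚ.* F ℚ.+ (N ℚ.* 2ℚ ℚ.- 2ℚ))) ℚ.- F₂)
      ≡⟨ cong (λ s → ℚ.½ ℚ.* ((F₂ ℚ.+ (2ℚ ℚ.* F ℚ.+ (s ℚ.- 2ℚ))) ℚ.- F₂)) (sum-degrees z) ⟨
    ℚ.½ ℚ.* ((F₂ ℚ.+ (2ℚ ℚ.* F ℚ.+ ((G ℚ.+ 2ℚ) ℚ.- 2ℚ))) ℚ.- F₂)
      ≡⟨ cong (λ s → ℚ.½ ℚ.* ((F₂ ℚ.+ (2ℚ ℚ.* F ℚ.+ s)) ℚ.- F₂)) (solve 1 (λ g → g :+ con 2ℚ :- con 2ℚ := g) refl G) ⟩
    ℚ.½ ℚ.* ((F₂ ℚ.+ (2ℚ ℚ.* F ℚ.+ G)) ℚ.- F₂)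
      ≡⟨ cong (λ s → ℚ.½ ℚ.* (s ℚ.- F₂)) (trans (sym rhs) (trans (sym (∑-cong E (λ x → laplacian-d² x z))) lhs)) ⟩
    ℚ.½ ℚ.* ((F₂ ℚ.+ (2ℚ ℚ.+ 2ℚ) ℚ.* D z) ℚ.- F₂)
      ≡⟨ solve 2 (λ f₂ d → con ℚ.½ :* ((f₂ :+ (con 2ℚ :+ con 2ℚ) :* d) :- f₂) := con 2ℚ :* d) refl F₂ (D z) ⟩
    2ℚ ℚ.* D z ∎
    where
    open ≡-Reasoning
    G  = ∑ E deg
    F  = ∑ E (λ x → deg x ℚ.* e x z)
    F₂ = ∑ E (λ x → deg x ℚ.* (e x z ℚ.* e x z))
    lhs : ∑ E (λ x → ∑ E (λ l → 𝔸 x l ℚ.* (e l z ℚ.* e l z)) ℚ.+ (2ℚ ℚ.+ 2ℚ) ℚ.* e x z)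
        ≡ F₂ ℚ.+ (2ℚ ℚ.+ 2ℚ) ℚ.* D z
    lhs = trans (∑-+ E (λ x → ∑ E (λ l → 𝔸 x l ℚ.* (e l z ℚ.* e l z))) (λ x → (2ℚ ℚ.+ 2ℚ) ℚ.* e x z))
      (cong₂ ℚ._+_ (∑∑A (λ l → e l z ℚ.* e l z))
        (trans (∑-*ˡ E (2ℚ ℚ.+ 2ℚ) (λ x → e x z))
               (cong ((2ℚ ℚ.+ 2ℚ) ℚ.*_) (trans (∑-cong E (λ x → cong ι (d-sym x z))) (sym (D≡∑ z))))))
    rhs : ∑ E (λ x → deg x ℚ.* ((e x z ℚ.+ 1ℚ) ℚ.* (e x z ℚ.+ 1ℚ))) ≡ F₂ ℚ.+ (2ℚ ℚ.* F ℚ.+ G)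
    rhs = trans
      (∑-cong E (λ x → solve 2 (λ g e → g :* ((e :+ con 1ℚ) :* (e :+ con 1ℚ))
                                     := g :* (e :* e) :+ (con 2ℚ :* (g :* e) :+ g)) refl (deg x) (e x z)))
      (trans (∑-+ E (λ x → deg x ℚ.* (e x z ℚ.* e x z)) (λ x → 2ℚ ℚ.* (deg x ℚ.* e x z) ℚ.+ deg x))
        (cong (F₂ ℚ.+_) (trans (∑-+ E (λ x → 2ℚ ℚ.* (deg x ℚ.* e x z)) deg)
                               (cong (ℚ._+ G) (∑-*ˡ E 2ℚ (λ x → deg x ℚ.* e x z))))))

  -- Mean first passage times

  passage : C → C → ℕ
  passage i j = (size V ℕ.* d i j ℕ.+ transmission j) ℕ.∸ (d i j ℕ.+ transmission i)

  -- The triangle inequality summed over all third vertices, where the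
  -- summand i alone leaves a slack of 2 d(i,j).
  d+d+transmission≤ : ∀ i j → d i j ℕ.+ (d i j ℕ.+ transmission i) ℕ.≤ size V ℕ.* d i j ℕ.+ transmission j
  d+d+transmission≤ i j = begin
    d i j ℕ.+ (d i j ℕ.+ transmission i)
      ≡⟨ ℕ.+-assoc (d i j) (d i j) (transmission i) ⟨
    (d i j ℕ.+ d i j) ℕ.+ transmission i
      ≡⟨ cong (ℕ._+ transmission i) (∑ℕ.∑-point _≟_ E unique (complete i) (λ _ → d i j ℕ.+ d i j)) ⟨
    ∑ℕ.∑ E (λ z → ∑ℕ.𝟙 (z ≟ i) ℕ.* (d i j ℕ.+ d i j)) ℕ.+ transmission i
      ≡⟨ ∑ℕ.∑-+ E (λ z → ∑ℕ.𝟙 (z ≟ i) ℕ.* (d i j ℕ.+ d i j)) (d i) ⟨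
    ∑ℕ.∑ E (λ z → ∑ℕ.𝟙 (z ≟ i) ℕ.* (d i j ℕ.+ d i j) ℕ.+ d i z)
      ≤⟨ ∑-mono-≤ E pointwise ⟩
    ∑ℕ.∑ E (λ z → d i j ℕ.+ d j z)
      ≡⟨ ∑ℕ.∑-+ E (λ _ → d i j) (d j) ⟩
    ∑ℕ.∑ E (λ _ → d i j) ℕ.+ transmission j
      ≡⟨ cong (ℕ._+ transmission j) (∑ℕ-const E (d i j)) ⟩
    size V ℕ.* d i j ℕ.+ transmission j ∎
    where
    open ℕ.≤-Reasoning
    pointwise : ∀ z → ∑ℕ.𝟙 (z ≟ i) ℕ.* (d i j ℕ.+ d i j) ℕ.+ d i z ℕ.≤ d i j ℕ.+ d j z
    pointwise z with z ≟ i
    ... | no _     = triangle z (d i j) refl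
    ... | yes refl = begin
      d i j ℕ.+ d i j ℕ.+ 0 ℕ.+ d i i   ≡⟨ cong₂ ℕ._+_ (ℕ.+-identityʳ (d i j ℕ.+ d i j)) (d-refl i) ⟩
      d i j ℕ.+ d i j ℕ.+ 0             ≡⟨ ℕ.+-identityʳ _ ⟩
      d i j ℕ.+ d i j                   ≡⟨ cong (d i j ℕ.+_) (d-sym i j) ⟩
      d i j ℕ.+ d j i                   ∎

  d≤passage : ∀ i j → d i j ℕ.≤ passage i j
  d≤passage i j = ℕ.m+n≤o⇒m≤o∸n (d i j) (d+d+transmission≤ i j)

  -- By `d+d+transmission≤` the subtraction in `passage` does not truncate.
  ι-passage : ∀ i j → ι (passage i j) ≡ (N ℚ.- 1ℚ) ℚ.* e i j ℚ.+ D j ℚ.- D i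
  ι-passage i j = begin
    p                                       ≡⟨ solve 3 (λ p e k → p := (p :+ (e :+ k)) :- (e :+ k)) refl p (e i j) (D i) ⟩
    (p ℚ.+ (e i j ℚ.+ D i)) ℚ.- (e i j ℚ.+ D i)
      ≡⟨ cong (λ s → (p ℚ.+ s) ℚ.- (e i j ℚ.+ D i)) (ι-+ (d i j) (transmission i)) ⟨
    (p ℚ.+ ι (d i j ℕ.+ transmission i)) ℚ.- (e i j ℚ.+ D i)
      ≡⟨ cong (ℚ._- (e i j ℚ.+ D i)) (ι-+ (passage i j) (d i j ℕ.+ transmission i)) ⟨
    ι (passage i j ℕ.+ (d i j ℕ.+ transmission i)) ℚ.- (e i j ℚ.+ D i)
      ≡⟨ cong (λ s → ι s ℚ.- (e i j ℚ.+ D i)) (ℕ.m∸n+n≡m (ℕ.m+n≤o⇒n≤o (d i j) (d+d+transmission≤ i j))) ⟩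
    ι (size V ℕ.* d i j ℕ.+ transmission j) ℚ.- (e i j ℚ.+ D i)
      ≡⟨ cong (ℚ._- (e i j ℚ.+ D i)) (trans (ι-+ _ (transmission j)) (cong (ℚ._+ D j) (ι-* (size V) (d i j)))) ⟩
    (N ℚ.* e i j ℚ.+ D j) ℚ.- (e i j ℚ.+ D i)
      ≡⟨ solve 4 (λ n e j i → (n :* e :+ j) :- (e :+ i) := (n :- con 1ℚ) :* e :+ j :- i) refl N (e i j) (D j) (D i) ⟩
    (N ℚ.- 1ℚ) ℚ.* e i j ℚ.+ D j ℚ.- D i ∎
    where
    open ≡-Reasoning
    p = ι (passage i j)

  passage-refl : ∀ i → ι (passage i i) ≡ 0ℚ
  passage-refl i = begin
    ι (passage i i)                        ≡⟨ ι-passage i i ⟩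
    (N ℚ.- 1ℚ) ℚ.* e i i ℚ.+ D i ℚ.- D i   ≡⟨ cong (λ k → (N ℚ.- 1ℚ) ℚ.* k ℚ.+ D i ℚ.- D i) (trans (cong ι (d-refl i)) ι-0) ⟩
    (N ℚ.- 1ℚ) ℚ.* 0ℚ ℚ.+ D i ℚ.- D i      ≡⟨ solve 2 (λ n k → (n :- con 1ℚ) :* con 0ℚ :+ k :- k := con 0ℚ) refl N (D i) ⟩
    0ℚ                                     ∎
    where open ≡-Reasoning

  -- The one-step equation, multiplied by the degree. Write L for adjacency minus degree. Then L
  -- d(·,j) = deg - 2 at x ≢ j, and summing `laplacian-d` over all z gives L D = n deg - 2 n + 2; so
  -- L maps (n - 1) d(·,j) - D to -deg at x, while the constant D(j) is killed.
  laplacian-passage : ∀ {x j} → x ≢ j →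
    ∑ E (λ l → 𝔸 x l ℚ.* ι (passage l j)) ≡ deg x ℚ.* (ι (passage x j) ℚ.- 1ℚ)
  laplacian-passage {x} {j} x≢j = begin
    ∑ E (λ l → 𝔸 x l ℚ.* ι (passage l j))
      ≡⟨ ∑-cong E (λ l → trans (cong (𝔸 x l ℚ.*_) (ι-passage l j))
           (solve 5 (λ a n e j l → a :* ((n :- con 1ℚ) :* e :+ j :- l)
                                := ((n :- con 1ℚ) :* (a :* e) :+ j :* a) :+ (:- con 1ℚ) :* (a :* l)) refl
              (𝔸 x l) N (e l j) (D j) (D l))) ⟩
    ∑ E (λ l → ((N ℚ.- 1ℚ) ℚ.* (𝔸 x l ℚ.* e l j) ℚ.+ D j ℚ.* 𝔸 x l) ℚ.+ (ℚ.- 1ℚ) ℚ.* (𝔸 x l ℚ.* D l))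
      ≡⟨ trans (∑-+ E (λ l → (N ℚ.- 1ℚ) ℚ.* (𝔸 x l ℚ.* e l j) ℚ.+ D j ℚ.* 𝔸 x l) (λ l → (ℚ.- 1ℚ) ℚ.* (𝔸 x l ℚ.* D l)))
           (cong₂ ℚ._+_
             (trans (∑-+ E (λ l → (N ℚ.- 1ℚ) ℚ.* (𝔸 x l ℚ.* e l j)) (λ l → D j ℚ.* 𝔸 x l))
               (cong₂ ℚ._+_ (∑-*ˡ E (N ℚ.- 1ℚ) (λ l → 𝔸 x l ℚ.* e l j))
                 (trans (∑-*ˡ E (D j) (𝔸 x)) (cong (D j ℚ.*_) (sym (deg≡∑ x))))))
             (∑-*ˡ E (ℚ.- 1ℚ) (λ l → 𝔸 x l ℚ.* D l))) ⟩
    ((N ℚ.- 1ℚ) ℚ.* S ℚ.+ D j ℚ.* deg x) ℚ.+ (ℚ.- 1ℚ) ℚ.* R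
      ≡⟨ cong₂ (λ s r → ((N ℚ.- 1ℚ) ℚ.* s ℚ.+ D j ℚ.* deg x) ℚ.+ (ℚ.- 1ℚ) ℚ.* r) S≡ R≡ ⟩
    ((N ℚ.- 1ℚ) ℚ.* (deg x ℚ.* (e x j ℚ.+ 1ℚ) ℚ.- 2ℚ) ℚ.+ D j ℚ.* deg x)
      ℚ.+ (ℚ.- 1ℚ) ℚ.* (deg x ℚ.* (D x ℚ.+ N) ℚ.+ 2ℚ ℚ.- N ℚ.* 2ℚ)
      ≡⟨ solve 5 (λ n g e j x →
           ((n :- con 1ℚ) :* (g :* (e :+ con 1ℚ) :- con 2ℚ) :+ j :* g)
             :+ (:- con 1ℚ) :* (g :* (x :+ n) :+ con 2ℚ :- n :* con 2ℚ)
           := g :* ((n :- con 1ℚ) :* e :+ j :- x :- con 1ℚ)) refl N (deg x) (e x j) (D j) (D x) ⟩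
    deg x ℚ.* ((N ℚ.- 1ℚ) ℚ.* e x j ℚ.+ D j ℚ.- D x ℚ.- 1ℚ)
      ≡⟨ cong (λ p → deg x ℚ.* (p ℚ.- 1ℚ)) (ι-passage x j) ⟨
    deg x ℚ.* (ι (passage x j) ℚ.- 1ℚ) ∎
    where
    open ≡-Reasoning
    S = ∑ E (λ l → 𝔸 x l ℚ.* e l j)
    R = ∑ E (λ l → 𝔸 x l ℚ.* D l)
    S≡ : S ≡ deg x ℚ.* (e x j ℚ.+ 1ℚ) ℚ.- 2ℚ
    S≡ = begin
      S                       ≡⟨ solve 1 (λ s → s := (s :+ con 2ℚ) :- con 2ℚ) refl S ⟩
      S ℚ.+ 2ℚ ℚ.- 2ℚ         ≡⟨ cong (ℚ._- 2ℚ) (laplacian-d x j) ⟩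
      deg x ℚ.* (e x j ℚ.+ 1ℚ) ℚ.+ 𝟙 (x ≟ j) ℚ.* 2ℚ ℚ.- 2ℚ
        ≡⟨ cong (λ b → deg x ℚ.* (e x j ℚ.+ 1ℚ) ℚ.+ b ℚ.* 2ℚ ℚ.- 2ℚ) (𝟙-no (x ≟ j) x≢j) ⟩
      deg x ℚ.* (e x j ℚ.+ 1ℚ) ℚ.+ 0ℚ ℚ.* 2ℚ ℚ.- 2ℚ
        ≡⟨ solve 1 (λ s → s :+ con 0ℚ :* con 2ℚ :- con 2ℚ := s :- con 2ℚ) refl (deg x ℚ.* (e x j ℚ.+ 1ℚ)) ⟩
      deg x ℚ.* (e x j ℚ.+ 1ℚ) ℚ.- 2ℚ ∎
    𝟙-sym : ∀ z → 𝟙 (x ≟ z) ≡ 𝟙 (z ≟ x)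
    𝟙-sym z = 𝟙-cong (x ≟ z) (z ≟ x) sym sym
    R≡ : R ≡ deg x ℚ.* (D x ℚ.+ N) ℚ.+ 2ℚ ℚ.- N ℚ.* 2ℚ
    R≡ = begin
      R
        ≡⟨ solve 2 (λ r n → r := (r :+ n :* con 2ℚ) :- n :* con 2ℚ) refl R N ⟩
      (R ℚ.+ N ℚ.* 2ℚ) ℚ.- N ℚ.* 2ℚ
        ≡⟨ cong (ℚ._- N ℚ.* 2ℚ) (begin
          R ℚ.+ N ℚ.* 2ℚ
            ≡⟨ cong₂ ℚ._+_ (∑-cong E (λ l → trans (cong (𝔸 x l ℚ.*_) (D≡∑ l)) (sym (∑-*ˡ E (𝔸 x l) (e l))))) (sym (∑ℚ-const E 2ℚ)) ⟩
          ∑ E (λ l → ∑ E (λ z → 𝔸 x l ℚ.* e l z)) ℚ.+ ∑ E (λ _ → 2ℚ)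
            ≡⟨ cong (ℚ._+ ∑ E (λ _ → 2ℚ)) (∑-swap E E (λ l z → 𝔸 x l ℚ.* e l z)) ⟩
          ∑ E (λ z → ∑ E (λ l → 𝔸 x l ℚ.* e l z)) ℚ.+ ∑ E (λ _ → 2ℚ)
            ≡⟨ ∑-+ E (λ z → ∑ E (λ l → 𝔸 x l ℚ.* e l z)) (λ _ → 2ℚ) ⟨
          ∑ E (λ z → ∑ E (λ l → 𝔸 x l ℚ.* e l z) ℚ.+ 2ℚ)
            ≡⟨ ∑-cong E (laplacian-d x) ⟩
          ∑ E (λ z → deg x ℚ.* (e x z ℚ.+ 1ℚ) ℚ.+ 𝟙 (x ≟ z) ℚ.* 2ℚ)
            ≡⟨ ∑-+ E (λ z → deg x ℚ.* (e x z ℚ.+ 1ℚ)) (λ z → 𝟙 (x ≟ z) ℚ.* 2ℚ) ⟩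
          ∑ E (λ z → deg x ℚ.* (e x z ℚ.+ 1ℚ)) ℚ.+ ∑ E (λ z → 𝟙 (x ≟ z) ℚ.* 2ℚ)
            ≡⟨ cong₂ ℚ._+_ (∑-*ˡ E (deg x) (λ z → e x z ℚ.+ 1ℚ)) (∑-cong E (λ z → cong (ℚ._* 2ℚ) (𝟙-sym z))) ⟩
          deg x ℚ.* ∑ E (λ z → e x z ℚ.+ 1ℚ) ℚ.+ ∑ E (λ z → 𝟙 (z ≟ x) ℚ.* 2ℚ)
            ≡⟨ cong₂ (λ s t → deg x ℚ.* s ℚ.+ t)
                 (trans (∑-+ E (e x) (λ _ → 1ℚ))
                   (cong₂ ℚ._+_ (sym (D≡∑ x)) (trans (∑ℚ-const E 1ℚ) (ℚ.*-identityʳ N))))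
                 (∑-point _≟_ E unique (complete x) (λ _ → 2ℚ)) ⟩
          deg x ℚ.* (D x ℚ.+ N) ℚ.+ 2ℚ ∎) ⟩
      deg x ℚ.* (D x ℚ.+ N) ℚ.+ 2ℚ ℚ.- N ℚ.* 2ℚ ∎

  others-split : ∀ j (f : C → ℚ) → ∑ E f ≡ f j ℚ.+ sumOver (others H j) f
  others-split j f = begin
    ∑ E f
      ≡⟨ ∑-cong E pointwise ⟩
    ∑ E (λ l → 𝟙 (l ≟ j) ℚ.* f l ℚ.+ 𝟙 (¬? (l ≟ j)) ℚ.* f l)
      ≡⟨ ∑-+ E (λ l → 𝟙 (l ≟ j) ℚ.* f l) (λ l → 𝟙 (¬? (l ≟ j)) ℚ.* f l) ⟩
    ∑ E (λ l → 𝟙 (l ≟ j) ℚ.* f l) ℚ.+ ∑ E (λ l → 𝟙 (¬? (l ≟ j)) ℚ.* f l)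
      ≡⟨ cong₂ ℚ._+_ (∑-point _≟_ E unique (complete j) f) (sym (∑-filter (λ l → ¬? (l ≟ j)) E f)) ⟩
    f j ℚ.+ sumOver (others H j) f ∎
    where
    open ≡-Reasoning
    pointwise : ∀ l → f l ≡ 𝟙 (l ≟ j) ℚ.* f l ℚ.+ 𝟙 (¬? (l ≟ j)) ℚ.* f l
    pointwise l with l ≟ j
    ... | yes _ = solve 1 (λ f → f := con 1ℚ :* f :+ con 0ℚ :* f) refl (f l)
    ... | no _  = solve 1 (λ f → f := con 0ℚ :* f :+ con 1ℚ :* f) refl (f l)

  others-∑ : ∀ j (f : C → ℚ) → f j ≡ 0ℚ → sumOver (others H j) f ≡ ∑ E f
  others-∑ j f fj≡0 = sym (trans (others-split j f)
    (trans (cong (ℚ._+ sumOver (others H j) f) fj≡0) (ℚ.+-identityˡ _)))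

  r : C → ℚ
  r x = ratio 1 (degree H x)

  -- The neighbour makes the degree nonzero, which rules out the convention for a zero denominator.
  r*deg≡1 : ∀ {x p} → Adj x p → r x ℚ.* deg x ≡ 1ℚ
  r*deg≡1 {x} {p} a with filter (adj? x) E | ∈-filter⁺ (adj? x) (complete p) a
  ... | _ ∷ ns | _ = trans (ratio-*-ι 1 (length ns)) ι-1

  transition≡ : ∀ x l → transition H x l ≡ r x ℚ.* 𝔸 x l
  transition≡ x l with does (adj? x l)
  ... | true  = sym (ℚ.*-identityʳ (r x))
  ... | false = sym (ℚ.*-zeroʳ (r x))

  0≤transition : ∀ x l → 0ℚ ℚ.≤ transition H x l
  0≤transition x l = subst (0ℚ ℚ.≤_) (sym (transition≡ x l)) (0≤* (0≤r (degree H x)) (0≤A (does (adj? x l))))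
    where
    0≤r : ∀ n → 0ℚ ℚ.≤ ratio 1 n
    0≤r zero    = ℚ.≤-refl
    0≤r (suc n) = ℚ.nonNegative⁻¹ _ {{ℚ.normalize-nonNeg 1 (suc n)}}
    0≤A : ∀ b → 0ℚ ℚ.≤ (if b then 1ℚ else 0ℚ)
    0≤A true  = subst (0ℚ ℚ.≤_) ι-1 (0≤ι 1)
    0≤A false = ℚ.≤-refl

  ∑transition : ∀ x (g : C → ℚ) → ∑ E (λ l → transition H x l ℚ.* g l) ≡ r x ℚ.* ∑ E (λ l → 𝔸 x l ℚ.* g l)
  ∑transition x g = trans
    (∑-cong E (λ l → trans (cong (ℚ._* g l) (transition≡ x l)) (ℚ.*-assoc (r x) (𝔸 x l) (g l))))
    (∑-*ˡ E (r x) (λ l → 𝔸 x l ℚ.* g l))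

  ∑transition≡1 : ∀ {x p} → Adj x p → ∑ E (λ l → transition H x l ℚ.* 1ℚ) ≡ 1ℚ
  ∑transition≡1 {x} a = begin
    ∑ E (λ l → transition H x l ℚ.* 1ℚ)     ≡⟨ ∑transition x (λ _ → 1ℚ) ⟩
    r x ℚ.* ∑ E (λ l → 𝔸 x l ℚ.* 1ℚ)        ≡⟨ cong (r x ℚ.*_) (∑A-const x 1ℚ) ⟩
    r x ℚ.* (deg x ℚ.* 1ℚ)                  ≡⟨ cong (r x ℚ.*_) (ℚ.*-identityʳ (deg x)) ⟩
    r x ℚ.* deg x                           ≡⟨ r*deg≡1 a ⟩
    1ℚ                                      ∎
    where open ≡-Reasoning

  passage-isMean : ∀ {i j} → i ≢ j → IsMeanFirstPassageTime H i j (ι (passage i j))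
  passage-isMean {i} {j} = partialMean⟶mean
    where
    m : C → ℚ
    m l = ι (passage l j)
    -- The sum of all passage times to j serves as a common upper bound for them.
    μ : ℕ
    μ = ∑ℕ.∑ E (λ l → passage l j)
    live : ∀ {l} → l ∈ others H j → l ≢ j
    live l∈ = proj₂ (∈-filter⁻ (λ l → ¬? (l ≟ j)) {xs = E} l∈)
    1≤m : ∀ {x} → x ≢ j → 1ℚ ℚ.≤ m x
    1≤m {x} x≢j with parent x≢j
    ... | _ , _ , d≡ = subst (ℚ._≤ m x) ι-1
      (ι-mono-≤ (ℕ.≤-trans (ℕ.≤-trans (s≤s z≤n) (ℕ.≤-reflexive (sym d≡))) (d≤passage x j)))
    m≤μ : ∀ {x} → x ≢ j → m x ℚ.≤ ι μ
    m≤μ {x} _ = subst (m x ℚ.≤_) (sym (ι-∑ E (λ l → passage l j)))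
      (term≤∑ E (λ l → 0≤ι (passage l j)) (complete x))
    mean : ∀ {x} → x ≢ j → m x ≡ 1ℚ ℚ.+ sumOver (others H j) (λ l → transition H x l ℚ.* m l)
    mean {x} x≢j = begin
      m x
        ≡⟨ solve 1 (λ m → m := con 1ℚ :+ con 1ℚ :* (m :- con 1ℚ)) refl (m x) ⟩
      1ℚ ℚ.+ 1ℚ ℚ.* (m x ℚ.- 1ℚ)
        ≡⟨ cong (λ o → 1ℚ ℚ.+ o ℚ.* (m x ℚ.- 1ℚ)) (r*deg≡1 (proj₁ (proj₂ (parent x≢j)))) ⟨
      1ℚ ℚ.+ r x ℚ.* deg x ℚ.* (m x ℚ.- 1ℚ)
        ≡⟨ cong (1ℚ ℚ.+_) (ℚ.*-assoc (r x) (deg x) (m x ℚ.- 1ℚ)) ⟩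
      1ℚ ℚ.+ r x ℚ.* (deg x ℚ.* (m x ℚ.- 1ℚ))
        ≡⟨ cong (λ s → 1ℚ ℚ.+ r x ℚ.* s) (laplacian-passage x≢j) ⟨
      1ℚ ℚ.+ r x ℚ.* ∑ E (λ l → 𝔸 x l ℚ.* m l)
        ≡⟨ cong (1ℚ ℚ.+_) (∑transition x m) ⟨
      1ℚ ℚ.+ ∑ E (λ l → transition H x l ℚ.* m l)
        ≡⟨ cong (1ℚ ℚ.+_) (others-∑ j (λ l → transition H x l ℚ.* m l)
             (trans (cong (transition H x j ℚ.*_) (passage-refl j)) (ℚ.*-zeroʳ (transition H x j)))) ⟨
      1ℚ ℚ.+ sumOver (others H j) (λ l → transition H x l ℚ.* m l) ∎
      where open ≡-Reasoning
    f₁ : ∀ {x} → x ≢ j → transition H x j ℚ.+ sumOver (others H j) (λ l → transition H x l ℚ.* 1ℚ) ≡ 1ℚ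
    f₁ {x} x≢j = begin
      transition H x j ℚ.+ sumOver (others H j) (λ l → transition H x l ℚ.* 1ℚ)
        ≡⟨ cong (ℚ._+ sumOver (others H j) (λ l → transition H x l ℚ.* 1ℚ)) (ℚ.*-identityʳ (transition H x j)) ⟨
      transition H x j ℚ.* 1ℚ ℚ.+ sumOver (others H j) (λ l → transition H x l ℚ.* 1ℚ)
        ≡⟨ others-split j (λ l → transition H x l ℚ.* 1ℚ) ⟨
      ∑ E (λ l → transition H x l ℚ.* 1ℚ)
        ≡⟨ ∑transition≡1 (proj₁ (proj₂ (parent x≢j))) ⟩
      1ℚ ∎
      where open ≡-Reasoning
    -- The walk is absorbed on its first visit to j, and the vertices other than j are the live
    -- states. The recursion of `firstPassage` is literally the one required of `f`.
    open Absorption (_≢ j) (others H j) live (transition H) 0≤transition m μ 1≤m m≤μ mean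
           (λ t l → firstPassage H l j t) f₁ (λ _ _ → refl)

  0<∑degree : ∀ {x y} → x ≢ y → 0 ℕ.< ∑ℕ.∑ E (degree H)
  0<∑degree {x} x≢y with parent x≢y
  ... | p , a , _ = ℕ.n≢0⇒n>0 λ ∑≡0 → ℕ.<⇒≢ (∈-length (∈-filter⁺ (adj? x) (complete p) a))
    (sym (∑-≤⇒≗ E (λ _ → z≤n) (ℕ.≤-reflexive (trans ∑≡0 (sym (∑ℕ.∑-zero E)))) (complete x)))

  ι2m≡∑deg : ι (2 ℕ.* edgeCount H) ≡ ∑ E deg
  ι2m≡∑deg = trans (cong ι (sym (handshake H))) (ι-∑ E (degree H))

  -- Evaluation of Kemeny's constant

  kemenyFrom : C → ℚ
  kemenyFrom i = sumOver (others H i) (λ j → stationary H j ℚ.* ι (passage i j))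

  -- The sum of the degrees, that is, the denominator of `stationary`.
  scale : ℚ
  scale = N ℚ.* 2ℚ ℚ.- 2ℚ

  -- After clearing the denominator the sum is Σ_j deg(j) m(i,j). Here D(i) occurs with coefficient
  -- 2 (n - 1) from the degree-weighted distances and with -2 (n - 1) from the sum of the degrees.
  -- That i drops out is the independence of the starting vertex.
  kemenyFrom*scale : ∀ {x y} → x ≢ y → ∀ i →
    kemenyFrom i ℚ.* scale ≡ 2ℚ ℚ.* ι wiener ℚ.- (2ℚ ℚ.* N ℚ.- 1ℚ) ℚ.* (N ℚ.- 1ℚ)
  kemenyFrom*scale {x} {y} x≢y i = begin
    kemenyFrom i ℚ.* scale
      ≡⟨ cong (kemenyFrom i ℚ.*_) scale≡∑deg ⟩
    kemenyFrom i ℚ.* ∑ E deg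
      ≡⟨ cong (ℚ._* ∑ E deg) (others-∑ i (λ j → stationary H j ℚ.* p j)
           (trans (cong (stationary H i ℚ.*_) (passage-refl i)) (ℚ.*-zeroʳ (stationary H i)))) ⟩
    ∑ E (λ j → stationary H j ℚ.* p j) ℚ.* ∑ E deg
      ≡⟨ ℚ.*-comm _ (∑ E deg) ⟩
    ∑ E deg ℚ.* ∑ E (λ j → stationary H j ℚ.* p j)
      ≡⟨ ∑-*ˡ E (∑ E deg) (λ j → stationary H j ℚ.* p j) ⟨
    ∑ E (λ j → ∑ E deg ℚ.* (stationary H j ℚ.* p j))
      ≡⟨ ∑-cong E (λ j → trans
           (solve 3 (λ g s p → g :* (s :* p) := s :* g :* p) refl (∑ E deg) (stationary H j) (p j))
           (cong₂ ℚ._*_ (stationary≡ j) (ι-passage i j))) ⟩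
    ∑ E (λ j → deg j ℚ.* ((N ℚ.- 1ℚ) ℚ.* e i j ℚ.+ D j ℚ.- D i))
      ≡⟨ ∑-cong E (λ j → solve 5 (λ g n e j i → g :* ((n :- con 1ℚ) :* e :+ j :- i)
           := (n :- con 1ℚ) :* (g :* e) :+ (g :* j :+ (:- i) :* g)) refl (deg j) N (e i j) (D j) (D i)) ⟩
    ∑ E (λ j → (N ℚ.- 1ℚ) ℚ.* (deg j ℚ.* e i j) ℚ.+ (deg j ℚ.* D j ℚ.+ (ℚ.- D i) ℚ.* deg j))
      ≡⟨ trans (∑-+ E (λ j → (N ℚ.- 1ℚ) ℚ.* (deg j ℚ.* e i j)) (λ j → deg j ℚ.* D j ℚ.+ (ℚ.- D i) ℚ.* deg j))
           (cong₂ ℚ._+_ (∑-*ˡ E (N ℚ.- 1ℚ) (λ j → deg j ℚ.* e i j))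
             (trans (∑-+ E (λ j → deg j ℚ.* D j) (λ j → (ℚ.- D i) ℚ.* deg j))
               (cong (X ℚ.+_) (∑-*ˡ E (ℚ.- D i) deg)))) ⟩
    (N ℚ.- 1ℚ) ℚ.* ∑ E (λ j → deg j ℚ.* e i j) ℚ.+ (X ℚ.+ (ℚ.- D i) ℚ.* ∑ E deg)
      ≡⟨ cong₂ (λ s t → (N ℚ.- 1ℚ) ℚ.* s ℚ.+ (X ℚ.+ (ℚ.- D i) ℚ.* t))
           (trans (∑-cong E (λ j → cong (λ k → deg j ℚ.* ι k) (d-sym i j))) (F≡ i)) (sym scale≡∑deg) ⟩
    (N ℚ.- 1ℚ) ℚ.* (2ℚ ℚ.* D i ℚ.- (N ℚ.- 1ℚ)) ℚ.+ (X ℚ.+ (ℚ.- D i) ℚ.* scale)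
      ≡⟨ cong (λ s → (N ℚ.- 1ℚ) ℚ.* (2ℚ ℚ.* D i ℚ.- (N ℚ.- 1ℚ)) ℚ.+ (s ℚ.+ (ℚ.- D i) ℚ.* scale)) X≡ ⟩
    (N ℚ.- 1ℚ) ℚ.* (2ℚ ℚ.* D i ℚ.- (N ℚ.- 1ℚ)) ℚ.+ ((2ℚ ℚ.* ι wiener ℚ.- N ℚ.* (N ℚ.- 1ℚ)) ℚ.+ (ℚ.- D i) ℚ.* scale)
      ≡⟨ solve 3 (λ n w i → (n :- con 1ℚ) :* (con 2ℚ :* i :- (n :- con 1ℚ))
             :+ ((con 2ℚ :* w :- n :* (n :- con 1ℚ)) :+ (:- i) :* (n :* con 2ℚ :- con 2ℚ))
           := con 2ℚ :* w :- (con 2ℚ :* n :- con 1ℚ) :* (n :- con 1ℚ)) refl N (ι wiener) (D i) ⟩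
    2ℚ ℚ.* ι wiener ℚ.- (2ℚ ℚ.* N ℚ.- 1ℚ) ℚ.* (N ℚ.- 1ℚ) ∎
    where
    open ≡-Reasoning
    p : C → ℚ
    p j = ι (passage i j)
    X : ℚ
    X = ∑ E (λ j → deg j ℚ.* D j)
    scale≡∑deg : scale ≡ ∑ E deg
    scale≡∑deg = trans (cong (ℚ._- 2ℚ) (sym (sum-degrees i)))
      (solve 1 (λ g → g :+ con 2ℚ :- con 2ℚ := g) refl (∑ E deg))
    F≡ : ∀ z → ∑ E (λ j → deg j ℚ.* e j z) ≡ 2ℚ ℚ.* D z ℚ.- (N ℚ.- 1ℚ)
    F≡ z = trans (solve 2 (λ f n → f := (f :+ n) :- n) refl (∑ E (λ j → deg j ℚ.* e j z)) (N ℚ.- 1ℚ))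
                 (cong (ℚ._- (N ℚ.- 1ℚ)) (sum-degree-distances z))
    stationary≡ : ∀ j → stationary H j ℚ.* ∑ E deg ≡ deg j
    stationary≡ j with 2 ℕ.* edgeCount H | ι2m≡∑deg | handshake H
    ... | suc k | ιk≡ | _ = trans (cong (ratio (degree H j) (suc k) ℚ.*_) (sym ιk≡)) (ratio-*-ι (degree H j) k)
    ... | zero  | _   | ∑≡0 = contradiction (sym ∑≡0) (ℕ.<⇒≢ (0<∑degree x≢y))
    -- Expanding D and exchanging the sums reduces the weighted sum of transmissions to the sums
    -- evaluated in `F≡`.
    X≡ : X ≡ 2ℚ ℚ.* ι wiener ℚ.- N ℚ.* (N ℚ.- 1ℚ)
    X≡ = begin
      X
        ≡⟨ ∑-cong E (λ j → trans (cong (deg j ℚ.*_) (D≡∑ j)) (sym (∑-*ˡ E (deg j) (e j)))) ⟩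
      ∑ E (λ j → ∑ E (λ z → deg j ℚ.* e j z))
        ≡⟨ ∑-swap E E (λ j z → deg j ℚ.* e j z) ⟩
      ∑ E (λ z → ∑ E (λ j → deg j ℚ.* e j z))
        ≡⟨ ∑-cong E F≡ ⟩
      ∑ E (λ z → 2ℚ ℚ.* D z ℚ.- (N ℚ.- 1ℚ))
        ≡⟨ ∑-+ E (λ z → 2ℚ ℚ.* D z) (λ _ → ℚ.- (N ℚ.- 1ℚ)) ⟩
      ∑ E (λ z → 2ℚ ℚ.* D z) ℚ.+ ∑ E (λ _ → ℚ.- (N ℚ.- 1ℚ))
        ≡⟨ cong₂ ℚ._+_ (trans (∑-*ˡ E 2ℚ D) (cong (2ℚ ℚ.*_) (sym (ι-∑ E transmission)))) (∑ℚ-const E (ℚ.- (N ℚ.- 1ℚ))) ⟩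
      2ℚ ℚ.* ι wiener ℚ.+ N ℚ.* (ℚ.- (N ℚ.- 1ℚ))
        ≡⟨ cong (2ℚ ℚ.* ι wiener ℚ.+_) (ℚ.neg-distribʳ-* N (N ℚ.- 1ℚ)) ⟨
      2ℚ ℚ.* ι wiener ℚ.- N ℚ.* (N ℚ.- 1ℚ) ∎

  0<scale : ∀ {x y} → x ≢ y → 0ℚ ℚ.< scale
  0<scale {x} {y} x≢y = begin-strict
    0ℚ                     ≡⟨ ι-0 ⟨
    ι 0                    <⟨ ι-mono-< (0<∑degree x≢y) ⟩
    ι (∑ℕ.∑ E (degree H))  ≡⟨ ι-∑ E (degree H) ⟩
    ∑ E deg                ≡⟨ solve 1 (λ g → g := g :+ con 2ℚ :- con 2ℚ) refl (∑ E deg) ⟩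
    ∑ E deg ℚ.+ 2ℚ ℚ.- 2ℚ  ≡⟨ cong (ℚ._- 2ℚ) (sum-degrees x) ⟩
    scale                  ∎
    where open ℚ.≤-Reasoning

  isKemeny : ∀ {x y} → x ≢ y → IsKemeny H (kemenyFrom x)
  isKemeny {x} x≢y i = (λ j → ι (passage i j)) , (λ j j≢i → passage-isMean (j≢i ∘ sym)) ,
    *-cancelʳ (0<scale x≢y) (trans (kemenyFrom*scale x≢y x) (sym (kemenyFrom*scale x≢y i)))

  -- A hypothesis H κ≤ H′ comes with unknown values and unknown mean passage times; uniqueness of
  -- limits identifies them with the computed ones.
  isKemeny⇒≡ : ∀ {κ} i → IsKemeny H κ → κ ≡ kemenyFrom i
  isKemeny⇒≡ i K with K i
  ... | m , m-mean , κ≡ = trans κ≡ (∑-cong-∈ (others H i) λ j j∈ →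
    let j≢i = proj₂ (∈-filter⁻ (λ l → ¬? (l ≟ i)) {xs = E} j∈) in
    cong (stationary H j ℚ.*_) (limit-unique {λ n → sumOver (upTo n) (λ t → ratio t 1 ℚ.* firstPassage H i j t)}
                                     (m-mean j j≢i) (passage-isMean (j≢i ∘ sym))))

-- Kemeny's constant and sums of distances of two trees

module _ {V : FinSet} {H H′ : Graph V} (T : TreeMetric H) (T′ : TreeMetric H′)
         {x y : Carrier V} (x≢y : x ≢ y) where
  open TreeMetricProperties using (wiener)
  open TreeKemeny

  private
    N c : ℚ
    N = ι (size V)
    c = ((1ℚ ℚ.+ 1ℚ) ℚ.* N ℚ.- 1ℚ) ℚ.* (N ℚ.- 1ℚ)

    ι-double : ∀ w → (1ℚ ℚ.+ 1ℚ) ℚ.* ι w ≡ ι (2 ℕ.* w)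
    ι-double w = trans (cong (λ o → (o ℚ.+ o) ℚ.* ι w) (sym ι-1))
      (trans (cong (ℚ._* ι w) (sym (ι-+ 1 1))) (sym (ι-* 2 w)))

    formula : {H : Graph V} (T : TreeMetric H) → kemenyFrom T x ℚ.* scale T ≡ ι (2 ℕ.* wiener T) ℚ.- c
    formula T = trans (kemenyFrom*scale T x≢y x) (cong (ℚ._- c) (ι-double (wiener T)))

  κ≤⇒wiener≤ : H κ≤ H′ → wiener T ℕ.≤ wiener T′
  κ≤⇒wiener≤ (κ , κ′ , K , K′ , κ≤κ′) = ℕ.*-cancelˡ-≤ 2 (ι-cancel-≤ (begin
    ι (2 ℕ.* wiener T)                 ≡⟨ solve 2 (λ w c → w := (w :- c) :+ c) refl (ι (2 ℕ.* wiener T)) c ⟩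
    ι (2 ℕ.* wiener T) ℚ.- c ℚ.+ c     ≡⟨ cong (ℚ._+ c) (formula T) ⟨
    kemenyFrom T x ℚ.* scale T ℚ.+ c   ≤⟨ ℚ.+-monoˡ-≤ c (ℚ.*-monoʳ-≤-nonNeg (scale T)
                                            {{ℚ.nonNegative (ℚ.<⇒≤ (0<scale T x≢y))}}
                                            (subst₂ ℚ._≤_ (isKemeny⇒≡ T x K) (isKemeny⇒≡ T′ x K′) κ≤κ′)) ⟩
    -- `scale` depends on the number of vertices alone, so `scale T` is also the factor for `T′`.
    kemenyFrom T′ x ℚ.* scale T ℚ.+ c  ≡⟨ cong (ℚ._+ c) (formula T′) ⟩
    ι (2 ℕ.* wiener T′) ℚ.- c ℚ.+ c    ≡⟨ solve 2 (λ w c → w := (w :- c) :+ c) refl (ι (2 ℕ.* wiener T′)) c ⟨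
    ι (2 ℕ.* wiener T′)                ∎))
    where
    open ℚ.≤-Reasoning
    open Data.Rational.Solver.+-*-Solver

  wiener≤⇒κ≤ : wiener T ℕ.≤ wiener T′ → H κ≤ H′
  wiener≤⇒κ≤ W≤W′ = kemenyFrom T x , kemenyFrom T′ x , isKemeny T x≢y , isKemeny T′ x≢y ,
    ℚ.*-cancelʳ-≤-pos (scale T) {{ℚ.positive (0<scale T x≢y)}} (begin
      kemenyFrom T x ℚ.* scale T     ≡⟨ formula T ⟩
      ι (2 ℕ.* wiener T) ℚ.- c       ≤⟨ ℚ.+-monoˡ-≤ (ℚ.- c) (ι-mono-≤ (ℕ.*-monoʳ-≤ 2 W≤W′)) ⟩
      ι (2 ℕ.* wiener T′) ℚ.- c      ≡⟨ formula T′ ⟨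
      kemenyFrom T′ x ℚ.* scale T    ∎)
    where open ℚ.≤-Reasoning

-- Paths in trees

module TreePaths {V : FinSet} (H : Graph V) (tree : IsTree H) where
  open FinSet V using (_≟_)
  open Graph H
  open DecMembership _≟_ using (_∈?_)

  private
    variable
      x y z : Carrier V

    steps : Walk H x z → ℕ
    steps ε       = 0
    steps (_ ◅ w) = suc (steps w)

    end∈ : (w : Walk H x z) → z ∈ visited H w
    end∈ ε       = here refl
    end∈ (_ ◅ w) = there (end∈ w)

    ∉⇒All≢ : {xs : List (Carrier V)} → x ∉ xs → All (x ≢_) xs
    ∉⇒All≢ x∉ = All.tabulate λ y∈ x≡y → x∉ (subst (_∈ _) (sym x≡y) y∈)

    All≢⇒∉ : {xs : List (Carrier V)} → All (x ≢_) xs → x ∉ xs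
    All≢⇒∉ x≢ x∈ = All.lookup x≢ x∈ refl

    suffix : (w : Walk H x z) → y ∈ visited H w → Walk H y z
    suffix ε       (here refl) = ε
    suffix (a ◅ w) (here refl) = a ◅ w
    suffix (a ◅ w) (there y∈)  = suffix w y∈

    suffix-⊆ : (w : Walk H x z) (y∈ : y ∈ visited H w) →
               ∀ {v} → v ∈ visited H (suffix w y∈) → v ∈ visited H w
    suffix-⊆ ε       (here refl) v∈ = v∈
    suffix-⊆ (a ◅ w) (here refl) v∈ = v∈
    suffix-⊆ (a ◅ w) (there y∈)  v∈ = there (suffix-⊆ w y∈ v∈)

    suffix-unique : (w : Walk H x z) (y∈ : y ∈ visited H w) →
                    Unique (visited H w) → Unique (visited H (suffix w y∈))
    suffix-unique ε       (here refl) u       = u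
    suffix-unique (a ◅ w) (here refl) u       = u
    suffix-unique (a ◅ w) (there y∈)  (_ ∷ u) = suffix-unique w y∈ u

    loopErase : (w : Walk H x z) →
      Σ (Walk H x z) λ p → Unique (visited H p) × (∀ {v} → v ∈ visited H p → v ∈ visited H w)
    loopErase ε = ε , [] ∷ [] , λ v∈ → v∈
    loopErase {x} (a ◅ w) with loopErase w
    ... | p , u , p⊆w with x ∈? visited H p
    ...   | yes x∈ = suffix p x∈ , suffix-unique p x∈ u , λ v∈ → there (p⊆w (suffix-⊆ p x∈ v∈))
    ...   | no  x∉ = a ◅ p , ∉⇒All≢ x∉ ∷ u , λ { (here refl) → here refl ; (there v∈) → there (p⊆w v∈) }

    prefixAvoiding : (w : Walk H x z) → y ∉ visited H w →
                     ∀ {v} → v ∈ visited H w → Star (AdjAvoiding H y) x v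
    prefixAvoiding ε       y∉ (here refl) = ε
    prefixAvoiding (a ◅ w) y∉ (here refl) = ε
    prefixAvoiding (a ◅ w) y∉ (there v∈)  =
      ((λ { refl → y∉ (here refl) }) , (λ { refl → y∉ (there (start∈ w)) }) , a)
        ◅ prefixAvoiding w (y∉ ∘ there) v∈
      where
      start∈ : (w : Walk H x z) → x ∈ visited H w
      start∈ ε       = here refl
      start∈ (_ ◅ _) = here refl

    walkAvoiding : x ≢ y → Star (AdjAvoiding H y) x z → Σ (Walk H x z) λ w → y ∉ visited H w
    walkAvoiding x≢y ε = ε , λ { (here refl) → x≢y refl }
    walkAvoiding x≢y ((_ , x′≢y , a) ◅ w) with walkAvoiding x′≢y w
    ... | w′ , y∉ = a ◅ w′ , λ { (here refl) → x≢y refl ; (there y∈) → y∉ y∈ }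

    -- A loop-erased walk from y to z off x would close up through x to a cycle. This is where
    -- acyclicity enters.
    neighbours-separated : Adj x y → Adj x z → Star (AdjAvoiding H x) y z → y ≡ z
    neighbours-separated {x} {y} {z} xy xz w with y ≟ z
    ... | yes y≡z = y≡z
    ... | no  y≢z with walkAvoiding (λ { refl → adj-irrefl refl xy }) w
    ... | w′ , x∉ with loopErase w′
    ... | ε     , _ , _    = contradiction refl y≢z
    ... | b ◅ q , u , q⊆w′ = contradiction (3≤ q)
      (proj₂ tree (adj-sym xz) (xy ◅ b ◅ q) (∉⇒All≢ (x∉ ∘ q⊆w′) ∷ u))
      where
      3≤ : ∀ {s} (q : Walk H s z) → 3 ℕ.≤ 2 ℕ.+ length (visited H q)
      3≤ ε       = ℕ.≤-refl
      3≤ (_ ◅ _) = s≤s (s≤s (s≤s z≤n))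

    common-target : ∀ {y′} → Adj x y → Adj x y′ → (w : Walk H y z) → x ∉ visited H w →
                    (w′ : Walk H y′ z) → x ∉ visited H w′ → y ≡ y′
    common-target xy xy′ w x∉w w′ x∉w′ = neighbours-separated xy xy′
      (prefixAvoiding w x∉w (end∈ w) ◅◅
       Star.reverse (λ (p , q , a) → q , p , adj-sym a) (prefixAvoiding w′ x∉w′ (end∈ w′)))

    -- By `common-target` two paths with the same ends agree step by step. Hence `dist`, read off
    -- from one chosen path, can be computed from any path.
    steps-unique : (p q : Walk H x z) → Unique (visited H p) → Unique (visited H q) → steps p ≡ steps q
    steps-unique ε       ε       _        _        = refl
    steps-unique ε       (_ ◅ q) _        (z≢ ∷ _) = contradiction (end∈ q) (All≢⇒∉ z≢)
    steps-unique (_ ◅ p) ε       (z≢ ∷ _) _        = contradiction (end∈ p) (All≢⇒∉ z≢)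
    steps-unique (a ◅ p) (b ◅ q) (x≢ ∷ u) (x≢′ ∷ u′)
      with refl ← common-target a b p (All≢⇒∉ x≢) q (All≢⇒∉ x≢′) = cong suc (steps-unique p q u u′)

    path : ∀ x z → Walk H x z
    path x z = proj₁ (loopErase (proj₂ (proj₁ tree) x z))

    path-unique : ∀ x z → Unique (visited H (path x z))
    path-unique x z = proj₁ (proj₂ (loopErase (proj₂ (proj₁ tree) x z)))

    dist : Carrier V → Carrier V → ℕ
    dist x z = steps (path x z)

    dist-path : (p : Walk H x z) → Unique (visited H p) → dist x z ≡ steps p
    dist-path {x} {z} p u = steps-unique (path x z) p (path-unique x z) u

    step-outside : Adj x y → x ∉ visited H (path y z) → dist x z ≡ suc (dist y z)
    step-outside {y = y} {z} a x∉ = dist-path (a ◅ path y z) (∉⇒All≢ x∉ ∷ path-unique y z)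

    -- The first step of the path leads to a neighbour of y that is joined to x off y, hence to x
    -- itself; what remains is a path from x to z.
    step-inside : Adj x y → x ∈ visited H (path y z) → dist y z ≡ suc (dist x z)
    step-inside {x} {y} {z} a x∈ with path y z | path-unique y z
    step-inside a (here refl) | ε     | _ = contradiction a (adj-irrefl refl)
    step-inside a (here refl) | b ◅ p | _ = contradiction a (adj-irrefl refl)
    step-inside a (there x∈)  | b ◅ p | y≢ ∷ u
      with refl ← neighbours-separated b (adj-sym a) (prefixAvoiding p (All≢⇒∉ y≢) x∈) =
      cong suc (sym (dist-path p u))

    dist-parent : x ≢ z → ∃[ p ] (Adj x p × dist x z ≡ suc (dist p z))
    dist-parent {x} {z} x≢z with path x z | path-unique x z
    ... | ε     | _     = contradiction refl x≢z
    ... | a ◅ p | _ ∷ u = _ , a , cong suc (sym (dist-path p u))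

    dist-step : Adj x y → ∀ z → dist x z ≡ suc (dist y z) ⊎ dist y z ≡ suc (dist x z)
    dist-step {x} {y} a z with x ∈? visited H (path y z)
    ... | yes x∈ = inj₂ (step-inside a x∈)
    ... | no  x∉ = inj₁ (step-outside a x∉)

    closer⇒avoids : Adj x y → dist x z ≡ suc (dist y z) → x ∉ visited H (path y z)
    closer⇒avoids a e x∈ = ℕ.<-asym (ℕ.≤-reflexive (sym e)) (ℕ.≤-reflexive (sym (step-inside a x∈)))

  treeMetric : TreeMetric H
  treeMetric = record
    { d             = dist
    ; d-refl        = λ z → dist-path ε ([] ∷ [])
    ; d-step        = dist-step
    ; parent        = dist-parent
    ; parent-unique = λ {x} {y} {y′} {z} a b e e′ →
        common-target a b (path y z) (closer⇒avoids a e) (path y′ z) (closer⇒avoids b e′)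
    }

open TreePaths public using (treeMetric)

-- Centroids

unique-⊆⇒length≤ : {xs ys : List A} → Unique xs → (∀ {x} → x ∈ xs → x ∈ ys) →
                   length xs ℕ.≤ length ys
unique-⊆⇒length≤ {xs = []}     _        _     = z≤n
unique-⊆⇒length≤ {xs = x ∷ xs} (x≢ ∷ u) xs⊆ys with ∈-∃++ (xs⊆ys (here refl))
... | as , bs , refl = begin
  suc (length xs)            ≤⟨ s≤s (unique-⊆⇒length≤ u delete) ⟩
  suc (length (as ++ bs))    ≡⟨ cong suc (length-++ as) ⟩
  suc (length as ℕ.+ length bs) ≡⟨ ℕ.+-suc (length as) (length bs) ⟨
  length as ℕ.+ suc (length bs) ≡⟨ length-++ as ⟨
  length (as ++ x ∷ bs)      ∎
  where
  open ℕ.≤-Reasoning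
  delete : ∀ {y} → y ∈ xs → y ∈ as ++ bs
  delete y∈ with ∈-++⁻ as (xs⊆ys (there y∈))
  ... | inj₁ y∈as         = ∈-++⁺ˡ y∈as
  ... | inj₂ (here y≡x)   = contradiction (sym y≡x) (All.lookup x≢ y∈)
  ... | inj₂ (there y∈bs) = ∈-++⁺ʳ as y∈bs

double≤⇒≤half : ∀ {m n} → m ℕ.+ m ℕ.≤ n → m ℕ.≤ ⌊ n /2⌋
double≤⇒≤half {m} m+m≤n = subst (ℕ._≤ _) (sym (ℕ.n≡⌊n+n/2⌋ m)) (ℕ.⌊n/2⌋-mono m+m≤n)

≤half⇒double≤ : ∀ {m n} → m ℕ.≤ ⌊ n /2⌋ → m ℕ.+ m ℕ.≤ n
≤half⇒double≤ {m} {n} m≤ = subst (m ℕ.+ m ℕ.≤_) (ℕ.⌊n/2⌋+⌈n/2⌉≡n n)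
  (ℕ.+-mono-≤ m≤ (ℕ.≤-trans m≤ (ℕ.⌊n/2⌋≤⌈n/2⌉ n)))

module Centroids {V : FinSet} {H : Graph V} (T : TreeMetric H) where
  open FinSet V using (_≟_; complete; unique)
  open Graph H
  open TreeMetricProperties T
  open ∑ℕ

  private
    C : Set
    C = Carrier V

    E : List C
    E = elements V

  Closer : C → C → C → Set
  Closer x y z = d x z ℕ.< d y z

  opaque
    closer? : ∀ x y z → Dec (Closer x y z)
    closer? x y z = d x z ℕ.<? d y z

  -- For an edge x ~ y of a tree, the order of the component of x after removal of that edge.
  branchSize : C → C → ℕ
  branchSize x y = ∑ E (λ z → 𝟙 (closer? x y z))

  ¬closer⇒suc : ∀ {x y z} → Adj x y → ¬ Closer x y z → d x z ≡ suc (d y z)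
  ¬closer⇒suc {z = z} a ¬closer with d-step a z
  ... | inj₁ e = e
  ... | inj₂ e = contradiction (ℕ.≤-reflexive (sym e)) ¬closer

  closer⇒suc : ∀ {x y z} → Adj x y → Closer x y z → d y z ≡ suc (d x z)
  closer⇒suc {z = z} a closer with d-step a z
  ... | inj₁ e = contradiction closer (ℕ.<-asym (ℕ.≤-reflexive (sym e)))
  ... | inj₂ e = e

  -- Moving from y to x gains 1 for every vertex on the side of x and loses 1 for every other
  -- vertex.
  transmission-step : ∀ {x y} → Adj x y →
    transmission x ℕ.+ (branchSize x y ℕ.+ branchSize x y) ≡ transmission y ℕ.+ size V
  transmission-step {x} {y} a = begin
    transmission x ℕ.+ (branchSize x y ℕ.+ branchSize x y)
      ≡⟨ cong (transmission x ℕ.+_) (∑-+ E b b) ⟨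
    transmission x ℕ.+ ∑ E (λ z → b z ℕ.+ b z)
      ≡⟨ ∑-+ E (d x) (λ z → b z ℕ.+ b z) ⟨
    ∑ E (λ z → d x z ℕ.+ (b z ℕ.+ b z))
      ≡⟨ ∑-cong E pointwise ⟩
    ∑ E (λ z → d y z ℕ.+ 1)
      ≡⟨ ∑-+ E (d y) (λ _ → 1) ⟩
    transmission y ℕ.+ ∑ E (λ _ → 1)
      ≡⟨ cong (transmission y ℕ.+_) (trans (∑ℕ-const E 1) (ℕ.*-identityʳ (size V))) ⟩
    transmission y ℕ.+ size V ∎
    where
    open ≡-Reasoning
    b : C → ℕ
    b z = 𝟙 (closer? x y z)
    pointwise : ∀ z → d x z ℕ.+ (b z ℕ.+ b z) ≡ d y z ℕ.+ 1
    pointwise z with closer? x y z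
    ... | yes c = trans (ℕ.+-suc (d x z) 1) (cong (ℕ._+ 1) (sym (closer⇒suc a c)))
    ... | no ¬c = trans (ℕ.+-identityʳ (d x z)) (trans (¬closer⇒suc a ¬c) (ℕ.+-comm 1 (d y z)))

  -- The distance to z is convex along paths without backtracking.
  keeps-receding : ∀ {a b c z} → Adj a b → Adj b c → a ≢ c →
                   d b z ≡ suc (d a z) → d c z ≡ suc (d b z)
  keeps-receding {z = z} ab bc a≢c e with d-step bc z
  ... | inj₁ e′ = contradiction (parent-unique (adj-sym ab) bc e e′) a≢c
  ... | inj₂ e′ = e′

  -- The branches are nested: a vertex beyond the edge a ~ b on the side of a recedes further on the
  -- step from b to c.
  branchSize-mono : ∀ {a b c} → Adj a b → Adj b c → a ≢ c → branchSize c b ℕ.≤ branchSize b a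
  branchSize-mono {a} {b} {c} ab bc a≢c = ∑-mono-≤ E pointwise
    where
    pointwise : ∀ z → 𝟙 (closer? c b z) ℕ.≤ 𝟙 (closer? b a z)
    pointwise z with closer? c b z | closer? b a z
    ... | no _   | _      = z≤n
    ... | yes _  | yes _  = ℕ.≤-refl
    ... | yes cb | no ¬ba = contradiction cb (ℕ.<-asym (ℕ.≤-reflexive
      (sym (keeps-receding ab bc a≢c (¬closer⇒suc (adj-sym ab) ¬ba)))))

  d-step-≤ʳ : ∀ {x y} → Adj x y → ∀ z → d z x ℕ.≤ suc (d z y)
  d-step-≤ʳ {x} {y} a z = subst₂ (λ m n → m ℕ.≤ suc n) (d-sym x z) (d-sym y z) (d-step-≤ a z)

  -- An edge off v stays in the branch at p. Otherwise y lies beyond another neighbour q of v. If q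
  -- also leads towards x then q = p; if not, comparing distances from q gives d v x < d v y, and
  -- comparing distances from p gives the reverse.
  closer-step : ∀ {v p x y} → Adj p v → y ≢ v → Adj x y → Closer p v x → Closer p v y
  closer-step {v} {p} {x} {y} pv y≢v xy closer with closer? p v y
  ... | yes c = c
  ... | no ¬c with parent (y≢v ∘ sym)
  ...   | q , vq , vy≡ with d-step vq x
  ...     | inj₁ vx≡ with refl ← parent-unique vq (adj-sym pv) vx≡ (closer⇒suc pv closer) =
    contradiction (ℕ.≤-reflexive (sym vy≡)) ¬c
  ...     | inj₂ qx≡ = contradiction vx<vy (ℕ.<-asym vy<vx)
    where
    open ℕ.≤-Reasoning
    vx<vy : d v x ℕ.< d v y
    vx<vy = begin
      suc (d v x)  ≡⟨ qx≡ ⟨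
      d q x        ≤⟨ d-step-≤ʳ xy q ⟩
      suc (d q y)  ≡⟨ vy≡ ⟨
      d v y        ∎
    vy<vx : d v y ℕ.< d v x
    vy<vx = begin
      suc (d v y)  ≡⟨ ¬closer⇒suc pv ¬c ⟨
      d p y        ≤⟨ d-step-≤ʳ (adj-sym xy) p ⟩
      suc (d p x)  ≡⟨ closer⇒suc pv closer ⟨
      d v x        ∎

  closer-component : ∀ {v p x y} → Adj p v → Star (AdjAvoiding H v) x y → Closer p v x → Closer p v y
  closer-component pv ε                        c = c
  closer-component pv ((_ , y≢v , a) ◅ w) c = closer-component pv w (closer-step pv y≢v a c)

  closer⇒≢ : ∀ {v p x} → Closer p v x → x ≢ v
  closer⇒≢ {v} c refl = contradiction (d-refl v) (ℕ.>⇒≢ (ℕ.≤-<-trans z≤n c))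

  -- The geodesic from w to p stays in the branch: if its next vertex were outside, v would be at
  -- least as close to w as p is.
  walkInBranch : ∀ {v p} → Adj p v → ∀ n w → d w p ≡ n → Closer p v w → Star (AdjAvoiding H v) w p
  walkInBranch pv zero    w wp≡ c with refl ← d≡0⇒≡ wp≡ = ε
  walkInBranch {v} {p} pv (suc n) w wp≡ c with parent (d≡suc⇒≢ wp≡)
  ... | w′ , ww′ , wp≡′ = (closer⇒≢ c , closer⇒≢ c′ , ww′)
    ◅ walkInBranch pv n w′ (ℕ.suc-injective (trans (sym wp≡′) wp≡)) c′
    where
    open ℕ.≤-Reasoning
    c′ : Closer p v w′
    c′ with closer? p v w′
    ... | yes c′ = c′
    ... | no ¬c′ = contradiction c (ℕ.≤⇒≯ (begin
      d v w               ≤⟨ d-step-≤ʳ ww′ v ⟩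
      suc (d v w′)        ≡⟨ ¬closer⇒suc pv ¬c′ ⟨
      d p w′              ≤⟨ ℕ.n≤1+n _ ⟩
      suc (d p w′)        ≡⟨ cong suc (d-sym p w′) ⟩
      suc (d w′ p)        ≡⟨ wp≡′ ⟨
      d w p               ≡⟨ d-sym w p ⟩
      d p w               ∎))

  branch : C → C → List C
  branch p v = filter (closer? p v) E

  branch-isComponent : ∀ {v p} → Adj p v → IsComponentWithout H v (branch p v)
  branch-isComponent {v} {p} pv = Unique.filter⁺ (closer? p v) unique , p , closer⇒≢ cp , λ w → mk⇔
    (λ w∈ → Star.reverse (λ (x≢ , y≢ , a) → y≢ , x≢ , adj-sym a)
      (walkInBranch pv (d w p) w refl (proj₂ (∈-filter⁻ (closer? p v) {xs = E} w∈))))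
    (λ walk → ∈-filter⁺ (closer? p v) (complete w) (closer-component pv walk cp))
    where
    cp : Closer p v p
    cp = ℕ.≤-reflexive (trans (cong suc (d-refl p)) (sym (adj⇒d≡1 (adj-sym pv))))

  Median : C → Set
  Median v = ∀ u → transmission v ℕ.≤ transmission u

  -- On the way from u to v no step increases the transmission, because the side left behind has at
  -- most half of the vertices. The hypothesis says so for the branches at v, and the branches
  -- further out are nested in those.
  centroid⇒median : ∀ {v} → IsCentroid H v → Median v
  centroid⇒median {v} centroid u = transmission-≤ (d u v) u refl
    where
    open ℕ.≤-Reasoning
    half : ∀ m {x x′} → d x v ≡ suc m → Adj x x′ → d x v ≡ suc (d x′ v) →
           branchSize x x′ ℕ.≤ ⌊ size V /2⌋
    half zero {x} xv≡ xx′ xv≡′ with refl ← d≡0⇒≡ (ℕ.suc-injective (trans (sym xv≡′) xv≡)) =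
      subst (ℕ._≤ ⌊ size V /2⌋) (sym (∑ℕ-𝟙 (closer? x v) E)) (centroid _ (branch-isComponent xx′))
    half (suc m) {x} {x′} xv≡ xx′ xv≡′ with parent (d≡suc⇒≢ (ℕ.suc-injective (trans (sym xv≡′) xv≡)))
    ... | x″ , x′x″ , x′v≡ = ℕ.≤-trans
      (branchSize-mono (adj-sym x′x″) (adj-sym xx′) λ { refl →
        ℕ.<-asym (ℕ.≤-reflexive (sym x′v≡)) (ℕ.≤-reflexive (sym xv≡′)) })
      (half m (ℕ.suc-injective (trans (sym xv≡′) xv≡)) x′x″ x′v≡)
    transmission-≤ : ∀ m x → d x v ≡ m → transmission v ℕ.≤ transmission x
    transmission-≤ zero    x xv≡ = ℕ.≤-reflexive (cong transmission (sym (d≡0⇒≡ xv≡)))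
    transmission-≤ (suc m) x xv≡ with parent (d≡suc⇒≢ xv≡)
    ... | x′ , xx′ , xv≡′ = ℕ.≤-trans (transmission-≤ m x′ (ℕ.suc-injective (trans (sym xv≡′) xv≡)))
      (ℕ.+-cancelʳ-≤ (size V) _ _ (begin
        transmission x′ ℕ.+ size V                        ≡⟨ transmission-step xx′ ⟨
        transmission x ℕ.+ (branchSize x x′ ℕ.+ branchSize x x′) ≤⟨ ℕ.+-monoʳ-≤ (transmission x)
                                                             (≤half⇒double≤ (half m xv≡ xx′ xv≡′)) ⟩
        transmission x ℕ.+ size V                         ∎))

  -- The component lies in the branch of the neighbour p of v towards u, and comparing the
  -- transmissions of v and p bounds that branch.
  median⇒centroid : ∀ {v} → Median v → IsCentroid H v
  median⇒centroid {v} median C (C-unique , u , u≢v , component) with parent (u≢v ∘ sym)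
  ... | p , vp , vu≡ = begin
    length C             ≤⟨ unique-⊆⇒length≤ C-unique (λ {w} w∈ → ∈-filter⁺ (closer? p v) (complete w)
                              (closer-component (adj-sym vp) (Equivalence.to (component w) w∈)
                                (ℕ.≤-reflexive (sym vu≡)))) ⟩
    length (branch p v)  ≡⟨ ∑ℕ-𝟙 (closer? p v) E ⟨
    branchSize p v       ≤⟨ double≤⇒≤half (ℕ.+-cancelˡ-≤ (transmission p) _ _ (begin
                              transmission p ℕ.+ (branchSize p v ℕ.+ branchSize p v)
                                ≡⟨ transmission-step (adj-sym vp) ⟩
                              transmission v ℕ.+ size V  ≤⟨ ℕ.+-monoˡ-≤ (size V) (median p) ⟩
                              transmission p ℕ.+ size V  ∎)) ⟩
    ⌊ size V /2⌋         ∎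
    where open ℕ.≤-Reasoning

-- Distances in chains

module ChainMetric {k : ℕ} {𝒯 : Graph (fin k)} {V : Fin k → FinSet} {G : ∀ i → Graph (V i)}
  (τ : TreeMetric 𝒯) (γ : ∀ i → TreeMetric (G i)) where

  open Graph 𝒯 using (Adj; adj-sym)
  open Chain
  private
    module 𝕋 = TreeMetricProperties τ
    module 𝔾 i = TreeMetricProperties (γ i)

  module Distance (K : Chain 𝒯 G) where

    -- Walk inside G_i to the endpoint of the bridge that leads towards j, cross it and continue.
    -- The explicit m makes the recursion structural.
    route : ∀ m i {j} → 𝕋.d i j ≡ m → Carrier (V i) → Carrier (V j) → ℕ
    route zero    i {j} e u v with refl ← 𝕋.d≡0⇒≡ e = 𝔾.d j u v
    route (suc m) i {j} e u v with 𝕋.parent (𝕋.d≡suc⇒≢ e)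
    ... | n , a , e′ = 𝔾.d i u (attach K i n a)
      ℕ.+ suc (route m n (ℕ.suc-injective (trans (sym e′) e)) (attach K n i (adj-sym a)) v)

    dist : (x y : Carrier (ChainVertex V)) → ℕ
    dist (i , u) (j , v) = route (𝕋.d i j) i refl u v

    route≡dist : ∀ m i {j} (e : 𝕋.d i j ≡ m) u v → route m i e u v ≡ dist (i , u) (j , v)
    route≡dist m i refl u v = refl

    dist-near : ∀ i u v → dist (i , u) (i , v) ≡ 𝔾.d i u v
    -- 𝕋.d i i is only propositionally 0, so `dist` is first rewritten as a `route` with m = 0.
    dist-near i u v = trans (sym (route≡dist 0 i (𝕋.d-refl i) u v)) (zero-route (𝕋.d-refl i))
      where
      zero-route : (e : 𝕋.d i i ≡ 0) → route 0 i e u v ≡ 𝔾.d i u v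
      zero-route e with refl ← 𝕋.d≡0⇒≡ e = refl

    -- Any neighbour of i closer to j will do, because uniqueness of parents in 𝒯 identifies it with
    -- the one that `route` follows.
    dist-far : ∀ {i j n} (a : Adj i n) → 𝕋.d i j ≡ suc (𝕋.d n j) → ∀ u v →
      dist (i , u) (j , v) ≡ 𝔾.d i u (attach K i n a) ℕ.+ suc (dist (n , attach K n i (adj-sym a)) (j , v))
    dist-far {i} {j} {n} a e u v = trans (sym (route≡dist (suc (𝕋.d n j)) i e u v)) suc-route
      where
      suc-route : route (suc (𝕋.d n j)) i e u v
                ≡ 𝔾.d i u (attach K i n a) ℕ.+ suc (dist (n , attach K n i (adj-sym a)) (j , v))
      suc-route with 𝕋.parent (𝕋.d≡suc⇒≢ e)
      ... | n′ , a′ , e′ with refl ← 𝕋.parent-unique a a′ e e′ =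
        cong (λ r → 𝔾.d i u (attach K i n a) ℕ.+ suc r) (route≡dist (𝕋.d n j) n (ℕ.suc-injective (trans (sym e′) e)) (attach K n i (adj-sym a)) v)

    bridge-inv : ∀ {i j u v} → Bridge K (i , u) (j , v) →
                 Σ (Adj i j) λ e → u ≡ attach K i j e × v ≡ attach K j i (adj-sym e)
    bridge-inv (bridge e) = e , refl , refl

    dist-bridge : ∀ {i n} (a : Adj i n) z → 𝕋.d i (proj₁ z) ≡ suc (𝕋.d n (proj₁ z)) →
                  dist (i , attach K i n a) z ≡ suc (dist (n , attach K n i (adj-sym a)) z)
    dist-bridge {i} {n} a (j , v) e = trans (dist-far a e (attach K i n a) v)
      (cong (ℕ._+ suc (dist (n , attach K n i (adj-sym a)) (j , v))) (𝔾.d-refl i (attach K i n a)))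

    closer-bridge : ∀ {i n u w} z → Bridge K (i , u) (n , w) → dist (i , u) z ≡ suc (dist (n , w) z) →
                    𝕋.d i (proj₁ z) ≡ suc (𝕋.d n (proj₁ z))
    closer-bridge z b e with bridge-inv b
    ... | a , refl , refl with 𝕋.d-step a (proj₁ z)
    ...   | inj₁ e′ = e′
    ...   | inj₂ e′ = contradiction (ℕ.≤-reflexive (sym (dist-bridge (adj-sym a) z e′)))
                                    (ℕ.<-asym (ℕ.≤-reflexive (sym e)))

    closer-inner : ∀ {i n u u′} (a : Adj i n) z → 𝕋.d i (proj₁ z) ≡ suc (𝕋.d n (proj₁ z)) →
                   dist (i , u) z ≡ suc (dist (i , u′) z) →
                   𝔾.d i u (attach K i n a) ≡ suc (𝔾.d i u′ (attach K i n a))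
    closer-inner {i} {n} {u} {u′} a z@(j , v) i→n e = ℕ.+-cancelʳ-≡ _ _ _
      (trans (sym (dist-far a i→n u v)) (trans e (cong suc (dist-far a i→n u′ v))))

    dist-refl : ∀ z → dist z z ≡ 0
    dist-refl (i , u) = trans (dist-near i u u) (𝔾.d-refl i u)

    private
      module K = Graph (chainGraph K)

    dist-step : ∀ {x y} → K.Adj x y → ∀ z → dist x z ≡ suc (dist y z) ⊎ dist y z ≡ suc (dist x z)
    dist-step (inj₂ (bridge a)) z with 𝕋.d-step a (proj₁ z)
    ... | inj₁ e = inj₁ (dist-bridge a z e)
    ... | inj₂ e = inj₂ (dist-bridge (adj-sym a) z e)
    dist-step (inj₁ (inner {i} {u} {u′} a)) (j , v) with i Fin.≟ j
    ... | yes refl rewrite dist-near i u v | dist-near i u′ v = 𝔾.d-step i a v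
    ... | no i≢j with 𝕋.parent i≢j
    ...   | n , b , e rewrite dist-far b e u v | dist-far b e u′ v
            with 𝔾.d-step i a (attach K i n b)
    ...     | inj₁ e′ = inj₁ (cong (ℕ._+ suc (dist (n , attach K n i (adj-sym b)) (j , v))) e′)
    ...     | inj₂ e′ = inj₂ (cong (ℕ._+ suc (dist (n , attach K n i (adj-sym b)) (j , v))) e′)

    dist-parent : ∀ {x z} → x ≢ z → ∃[ p ] (K.Adj x p × dist x z ≡ suc (dist p z))
    dist-parent {i , u} {j , v} x≢z with i Fin.≟ j
    dist-parent {i , u} {.i , v} x≢z | yes refl with 𝔾.parent i (x≢z ∘ cong (i ,_))
    ... | p , a , e = (i , p) , inj₁ (inner a) ,
      trans (dist-near i u v) (trans e (cong suc (sym (dist-near i p v))))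
    dist-parent {i , u} {j , v} x≢z | no i≢j with 𝕋.parent i≢j
    ... | n , a , e with FinSet._≟_ (V i) u (attach K i n a)
    ...   | yes refl = _ , inj₂ (bridge a) , dist-bridge a (j , v) e
    ...   | no u≢ with 𝔾.parent i u≢
    ...     | p , b , e′ = (i , p) , inj₁ (inner b) , trans (dist-far a e u v)
                (trans (cong (ℕ._+ suc (dist (n , attach K n i (adj-sym a)) (j , v))) e′)
                       (cong suc (sym (dist-far a e p v))))

    -- If the bridge leads towards z, its endpoint u is at distance 0 from the exit of G_i, so no
    -- neighbour inside G_i can be closer.
    inner-bridge-⊥ : ∀ {i n u u′ w} z → Bridge K (i , u) (n , w) →
                     dist (i , u) z ≡ suc (dist (i , u′) z) → dist (i , u) z ≢ suc (dist (n , w) z)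
    inner-bridge-⊥ {i} {n} z b e e′ with bridge-inv b | closer-bridge z b e′
    ... | a , refl , refl | i→n
      with () ← trans (sym (𝔾.d-refl i (attach K i n a))) (closer-inner a z i→n e)

    dist-parent-unique : ∀ {x y y′ z} → K.Adj x y → K.Adj x y′ →
      dist x z ≡ suc (dist y z) → dist x z ≡ suc (dist y′ z) → y ≡ y′
    dist-parent-unique {i , u} {n , w} {n′ , w′} {z} (inj₂ b) (inj₂ b′) e e′
      with bridge-inv b | closer-bridge z b e | bridge-inv b′ | closer-bridge z b′ e′
    ... | a , _ , refl | i→n | a′ , _ , refl | i→n′ with refl ← 𝕋.parent-unique a a′ i→n i→n′ = refl
    dist-parent-unique {z = z} (inj₁ (inner _)) (inj₂ b) e e′ = contradiction e′ (inner-bridge-⊥ z b e)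
    dist-parent-unique {z = z} (inj₂ b) (inj₁ (inner _)) e e′ = contradiction e (inner-bridge-⊥ z b e′)
    dist-parent-unique {z = j , v} (inj₁ (inner {i} {u} {w} a)) (inj₁ (inner {v = w′} a′)) e e′
      with i Fin.≟ j
    ... | no i≢j with 𝕋.parent i≢j
    ...   | n , b , i→n = cong (i ,_) (𝔾.parent-unique i a a′
              (closer-inner b (j , v) i→n e) (closer-inner b (j , v) i→n e′))
    dist-parent-unique {z = j , v} (inj₁ (inner {i} {u} {w} a)) (inj₁ (inner {v = w′} a′)) e e′
        | yes refl = cong (i ,_) (𝔾.parent-unique i a a′
              (trans (sym (dist-near i u v)) (trans e (cong suc (dist-near i w v))))
              (trans (sym (dist-near i u v)) (trans e′ (cong suc (dist-near i w′ v)))))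

    chainMetric : TreeMetric (chainGraph K)
    chainMetric = record
      { d             = dist
      ; d-refl        = dist-refl
      ; d-step        = dist-step
      ; parent        = dist-parent
      ; parent-unique = dist-parent-unique
      }

  ∑-disjointUnion : (f : Carrier (ChainVertex V) → ℕ) →
    ∑ℕ.∑ (elements (ChainVertex V)) f ≡ ∑ℕ.∑ (allFin k) (λ i → ∑ℕ.∑ (elements (V i)) (λ u → f (i , u)))
  ∑-disjointUnion f = trans (∑ℕ.∑-concatMap _ (allFin k) f)
    (∑ℕ.∑-cong (allFin k) (λ i → ∑ℕ.∑-map (i ,_) (elements (V i)) f))

  -- Minimising the sum of distances over chains

  module Wiener (med : ∀ i → Carrier (V i)) (median : ∀ i → Centroids.Median (γ i) (med i)) where
    open ∑ℕ

    private
      n : Fin k → ℕ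
      n i = size (V i)

    c : Fin k → ℕ
    c i = 𝔾.transmission i (med i)

    -- Bounds for distanceSum i u j and total i j below.
    lower : Fin k → Fin k → ℕ
    lower i j = 𝕋.d i j ℕ.* n j ℕ.+ c j

    lowerTotal : Fin k → Fin k → ℕ
    lowerTotal i j = n j ℕ.* c i ℕ.+ n i ℕ.* lower i j

    lower-suc : ∀ {i j p} → 𝕋.d i j ≡ suc (𝕋.d p j) → lower i j ≡ n j ℕ.+ lower p j
    lower-suc {i} {j} {p} e rewrite e = ℕ.+-assoc (n j) (𝕋.d p j ℕ.* n j) (c j)

    module _ (K : Chain 𝒯 G) where
      open Distance K

      distanceSum : (i : Fin k) → Carrier (V i) → Fin k → ℕ
      distanceSum i u j = ∑ (elements (V j)) (λ v → dist (i , u) (j , v))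

      total : Fin k → Fin k → ℕ
      total i j = ∑ (elements (V i)) (λ u → distanceSum i u j)

      wiener≡∑total : TreeMetricProperties.wiener chainMetric ≡ ∑ (allFin k) (λ i → ∑ (allFin k) (total i))
      wiener≡∑total = trans (∑-disjointUnion (TreeMetricProperties.transmission chainMetric))
        (∑-cong (allFin k) λ i → trans
          (∑-cong (elements (V i)) (λ u → ∑-disjointUnion (dist (i , u))))
          (∑-swap (elements (V i)) (allFin k) (distanceSum i)))

      distanceSum-near : ∀ i u → distanceSum i u i ≡ 𝔾.transmission i u
      distanceSum-near i u = ∑-cong (elements (V i)) (dist-near i u)

      distanceSum-far : ∀ {i j p} (a : Adj i p) → 𝕋.d i j ≡ suc (𝕋.d p j) → ∀ u →
        distanceSum i u j ≡ n j ℕ.* 𝔾.d i u (attach K i p a)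
                              ℕ.+ (n j ℕ.+ distanceSum p (attach K p i (adj-sym a)) j)
      distanceSum-far {i} {j} {p} a e u = begin
        ∑ E (λ v → dist (i , u) (j , v))
          ≡⟨ ∑-cong E (λ v → trans (dist-far a e u v) (ℕ.+-suc δ (r v))) ⟩
        ∑ E (λ v → suc δ ℕ.+ r v)
          ≡⟨ ∑-+ E (λ _ → suc δ) r ⟩
        ∑ E (λ _ → suc δ) ℕ.+ ∑ E r
          ≡⟨ cong (ℕ._+ ∑ E r) (trans (∑ℕ-const E (suc δ)) (trans (ℕ.*-suc (n j) δ) (ℕ.+-comm (n j) (n j ℕ.* δ)))) ⟩
        n j ℕ.* δ ℕ.+ n j ℕ.+ ∑ E r
          ≡⟨ ℕ.+-assoc (n j ℕ.* δ) (n j) (∑ E r) ⟩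
        n j ℕ.* δ ℕ.+ (n j ℕ.+ ∑ E r) ∎
        where
        open ≡-Reasoning
        E = elements (V j)
        δ = 𝔾.d i u (attach K i p a)
        r : Carrier (V j) → ℕ
        r v = dist (p , attach K p i (adj-sym a)) (j , v)

      total-near : ∀ i → total i i ≡ 𝔾.wiener i
      total-near i = ∑-cong (elements (V i)) (distanceSum-near i)

      total-far : ∀ {i j p} (a : Adj i p) → 𝕋.d i j ≡ suc (𝕋.d p j) →
        total i j ≡ n j ℕ.* 𝔾.transmission i (attach K i p a)
                      ℕ.+ n i ℕ.* (n j ℕ.+ distanceSum p (attach K p i (adj-sym a)) j)
      total-far {i} {j} {p} a e = begin
        ∑ E (λ u → distanceSum i u j)
          ≡⟨ ∑-cong E (distanceSum-far a e) ⟩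
        ∑ E (λ u → n j ℕ.* 𝔾.d i u (attach K i p a) ℕ.+ R)
          ≡⟨ ∑-+ E (λ u → n j ℕ.* 𝔾.d i u (attach K i p a)) (λ _ → R) ⟩
        ∑ E (λ u → n j ℕ.* 𝔾.d i u (attach K i p a)) ℕ.+ ∑ E (λ _ → R)
          ≡⟨ cong₂ ℕ._+_
               (trans (∑-*ˡ E (n j) (λ u → 𝔾.d i u (attach K i p a)))
                 (cong (n j ℕ.*_) (∑-cong E (λ u → 𝔾.d-sym i u (attach K i p a)))))
               (∑ℕ-const E R) ⟩
        n j ℕ.* 𝔾.transmission i (attach K i p a) ℕ.+ n i ℕ.* R ∎
        where
        open ≡-Reasoning
        E = elements (V i)
        R = n j ℕ.+ distanceSum p (attach K p i (adj-sym a)) j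

      -- Each of the n_j targets costs one bridge per step in 𝒯; the detours inside intermediate
      -- graphs are dropped, and the sum inside G_j is a transmission, at least c_j.
      lower≤distanceSum : ∀ i u j → lower i j ℕ.≤ distanceSum i u j
      lower≤distanceSum i u j = go (𝕋.d i j) i u refl
        where
        open ℕ.≤-Reasoning
        go : ∀ m i u → 𝕋.d i j ≡ m → lower i j ℕ.≤ distanceSum i u j
        go zero i u e with refl ← 𝕋.d≡0⇒≡ e = begin
          𝕋.d i i ℕ.* n i ℕ.+ c i  ≡⟨ cong (λ t → t ℕ.* n i ℕ.+ c i) e ⟩
          c i                      ≤⟨ median i u ⟩
          𝔾.transmission i u       ≡⟨ distanceSum-near i u ⟨
          distanceSum i u i        ∎
        go (suc m) i u e with 𝕋.parent (𝕋.d≡suc⇒≢ e)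
        ... | p , a , e′ = begin
          lower i j                      ≡⟨ lower-suc e′ ⟩
          n j ℕ.+ lower p j              ≤⟨ ℕ.+-monoʳ-≤ (n j) (go m p _ (ℕ.suc-injective (trans (sym e′) e))) ⟩
          n j ℕ.+ distanceSum p (attach K p i (adj-sym a)) j
                                         ≤⟨ ℕ.m≤n+m _ (n j ℕ.* 𝔾.d i u (attach K i p a)) ⟩
          n j ℕ.* 𝔾.d i u (attach K i p a) ℕ.+ (n j ℕ.+ distanceSum p (attach K p i (adj-sym a)) j)
                                         ≡⟨ distanceSum-far a e′ u ⟨
          distanceSum i u j              ∎

      lowerTotal≤total : ∀ {i j} → i ≢ j → lowerTotal i j ℕ.≤ total i j
      lowerTotal≤total {i} {j} i≢j with 𝕋.parent i≢j
      ... | p , a , e = begin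
        n j ℕ.* c i ℕ.+ n i ℕ.* lower i j
          ≡⟨ cong (λ l → n j ℕ.* c i ℕ.+ n i ℕ.* l) (lower-suc e) ⟩
        n j ℕ.* c i ℕ.+ n i ℕ.* (n j ℕ.+ lower p j)
          ≤⟨ ℕ.+-mono-≤ (ℕ.*-monoʳ-≤ (n j) (median i (attach K i p a)))
               (ℕ.*-monoʳ-≤ (n i) (ℕ.+-monoʳ-≤ (n j) (lower≤distanceSum p (attach K p i (adj-sym a)) j))) ⟩
        n j ℕ.* 𝔾.transmission i (attach K i p a)
          ℕ.+ n i ℕ.* (n j ℕ.+ distanceSum p (attach K p i (adj-sym a)) j)
          ≡⟨ total-far a e ⟨
        total i j ∎
        where open ℕ.≤-Reasoning

      -- The two summands of `total-far` are bounded below separately, so tightness of their sum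
      -- makes both bounds tight. Orders are cancelled, being positive by the existence of `med`.
      module Tight {i j p} (a : Adj i p) (e : 𝕋.d i j ≡ suc (𝕋.d p j)) (tight : total i j ℕ.≤ lowerTotal i j) where
        private
          D R : ℕ
          D = 𝔾.transmission i (attach K i p a)
          R = distanceSum p (attach K p i (adj-sym a)) j

          tight′ : n j ℕ.* D ℕ.+ n i ℕ.* (n j ℕ.+ R) ℕ.≤ n j ℕ.* c i ℕ.+ n i ℕ.* (n j ℕ.+ lower p j)
          tight′ = subst₂ ℕ._≤_ (total-far a e) (cong (λ l → n j ℕ.* c i ℕ.+ n i ℕ.* l) (lower-suc e)) tight

          nonZero : ∀ i → ℕ.NonZero (n i)
          nonZero i = ℕ.>-nonZero (∈-length (FinSet.complete (V i) (med i)))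

        attach-median : Centroids.Median (γ i) (attach K i p a)
        attach-median u = ℕ.≤-trans (ℕ.*-cancelˡ-≤ (n j) {{nonZero j}} (ℕ.+-cancelʳ-≤ (n i ℕ.* (n j ℕ.+ R)) _ _
          (ℕ.≤-trans tight′ (ℕ.+-monoʳ-≤ (n j ℕ.* c i) (ℕ.*-monoʳ-≤ (n i)
            (ℕ.+-monoʳ-≤ (n j) (lower≤distanceSum p (attach K p i (adj-sym a)) j))))))) (median i u)

        distanceSum≤lower : distanceSum p (attach K p i (adj-sym a)) j ℕ.≤ lower p j
        distanceSum≤lower = ℕ.+-cancelˡ-≤ (n j) R (lower p j) (ℕ.*-cancelˡ-≤ (n i) {{nonZero i}}
          (ℕ.+-cancelˡ-≤ (n j ℕ.* D) _ _ (ℕ.≤-trans tight′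
            (ℕ.+-monoˡ-≤ _ (ℕ.*-monoʳ-≤ (n j) (median i (attach K i p a)))))))

      adj⇒d : ∀ {i p} → Adj i p → 𝕋.d i p ≡ suc (𝕋.d p p)
      adj⇒d {i} {p} a = trans (𝕋.adj⇒d≡1 a) (cong suc (sym (𝕋.d-refl p)))

      Tightness : Set
      Tightness = ∀ i j → i ≢ j → total i j ℕ.≤ lowerTotal i j

      tight⇒attach-median : Tightness → ∀ {i p} (a : Adj i p) → Centroids.Median (γ i) (attach K i p a)
      tight⇒attach-median tight {i} {p} a =
        Tight.attach-median a (adj⇒d a) (tight i p (𝕋.d≡suc⇒≢ (adj⇒d a)))

      -- For q ≢ r the route from G_q to G_r enters G_p at one attachment vertex and leaves at the
      -- other. Their distance δ is paid for each of the n_r targets on top of the bound, and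
      -- tightness for (q,r) leaves no room for it.
      tight⇒attach-≡ : Tightness → ∀ {p q r} (a : Adj p q) (b : Adj p r) → attach K p q a ≡ attach K p r b
      tight⇒attach-≡ tight {p} {q} {r} a b with q Fin.≟ r
      ... | yes refl = refl
      ... | no q≢r = 𝔾.d≡0⇒≡ p (ℕ.n≤0⇒n≡0 (ℕ.*-cancelˡ-≤ (n r) {{ℕ.>-nonZero (∈-length (FinSet.complete (V r) (med r)))}}
          (ℕ.≤-trans nδ≤0 z≤n)))
        where
        open ℕ.≤-Reasoning
        δ : ℕ
        δ = 𝔾.d p (attach K p q a) (attach K p r b)
        -- The distinct neighbours q and r of p have p between them: the other alternative would
        -- give distance 0.
        qr : 𝕋.d q r ≡ suc (𝕋.d p r)
        qr with 𝕋.d-step (adj-sym a) r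
        ... | inj₁ e = e
        ... | inj₂ e = contradiction (𝕋.d≡0⇒≡ (ℕ.suc-injective (trans (sym e) (𝕋.adj⇒d≡1 b)))) q≢r
        nδ≤0 : n r ℕ.* δ ℕ.≤ 0
        nδ≤0 = ℕ.+-cancelʳ-≤ (n r ℕ.+ lower r r) _ _ (begin
          n r ℕ.* δ ℕ.+ (n r ℕ.+ lower r r)
            ≤⟨ ℕ.+-monoʳ-≤ (n r ℕ.* δ) (ℕ.+-monoʳ-≤ (n r) (lower≤distanceSum r (attach K r p (adj-sym b)) r)) ⟩
          n r ℕ.* δ ℕ.+ (n r ℕ.+ distanceSum r (attach K r p (adj-sym b)) r)
            ≡⟨ distanceSum-far b (adj⇒d b) (attach K p q a) ⟨
          distanceSum p (attach K p q a) r
            ≤⟨ Tight.distanceSum≤lower (adj-sym a) qr (tight q r q≢r) ⟩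
          lower p r
            ≡⟨ lower-suc (adj⇒d b) ⟩
          n r ℕ.+ lower r r ∎)

      module Ideal (v : ∀ i → Carrier (V i)) (v-median : ∀ i → Centroids.Median (γ i) (v i))
                   (attach≡v : ∀ {i p} (a : Adj i p) → attach K i p a ≡ v i) where

        transmission≡c : ∀ i → 𝔾.transmission i (v i) ≡ c i
        transmission≡c i = ℕ.≤-antisym (v-median i (med i)) (median i (v i))

        distanceSum≡lower : ∀ i j → distanceSum i (v i) j ≡ lower i j
        distanceSum≡lower i j = go (𝕋.d i j) i refl
          where
          open ≡-Reasoning
          go : ∀ m i → 𝕋.d i j ≡ m → distanceSum i (v i) j ≡ lower i j
          go zero i e with refl ← 𝕋.d≡0⇒≡ e = begin
            distanceSum i (v i) i     ≡⟨ distanceSum-near i (v i) ⟩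
            𝔾.transmission i (v i)    ≡⟨ transmission≡c i ⟩
            c i                       ≡⟨ cong (λ t → t ℕ.* n i ℕ.+ c i) e ⟨
            lower i i                 ∎
          go (suc m) i e with 𝕋.parent (𝕋.d≡suc⇒≢ e)
          ... | p , a , e′ = begin
            distanceSum i (v i) j
              ≡⟨ distanceSum-far a e′ (v i) ⟩
            n j ℕ.* 𝔾.d i (v i) (attach K i p a) ℕ.+ (n j ℕ.+ distanceSum p (attach K p i (adj-sym a)) j)
              ≡⟨ cong₂ (λ s t → n j ℕ.* 𝔾.d i (v i) s ℕ.+ (n j ℕ.+ distanceSum p t j)) (attach≡v a) (attach≡v (adj-sym a)) ⟩
            n j ℕ.* 𝔾.d i (v i) (v i) ℕ.+ (n j ℕ.+ distanceSum p (v p) j)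
              ≡⟨ cong₂ (λ s t → s ℕ.+ (n j ℕ.+ t)) (trans (cong (n j ℕ.*_) (𝔾.d-refl i (v i))) (ℕ.*-zeroʳ (n j)))
                   (go m p (ℕ.suc-injective (trans (sym e′) e))) ⟩
            n j ℕ.+ lower p j
              ≡⟨ lower-suc e′ ⟨
            lower i j ∎

        total≡lowerTotal : ∀ {i j} → i ≢ j → total i j ≡ lowerTotal i j
        total≡lowerTotal {i} {j} i≢j with 𝕋.parent i≢j
        ... | p , a , e = begin
          total i j
            ≡⟨ total-far a e ⟩
          n j ℕ.* 𝔾.transmission i (attach K i p a) ℕ.+ n i ℕ.* (n j ℕ.+ distanceSum p (attach K p i (adj-sym a)) j)
            ≡⟨ cong₂ (λ s t → n j ℕ.* 𝔾.transmission i s ℕ.+ n i ℕ.* (n j ℕ.+ distanceSum p t j))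
                 (attach≡v a) (attach≡v (adj-sym a)) ⟩
          n j ℕ.* 𝔾.transmission i (v i) ℕ.+ n i ℕ.* (n j ℕ.+ distanceSum p (v p) j)
            ≡⟨ cong₂ (λ s t → n j ℕ.* s ℕ.+ n i ℕ.* (n j ℕ.+ t)) (transmission≡c i) (distanceSum≡lower p j) ⟩
          n j ℕ.* c i ℕ.+ n i ℕ.* (n j ℕ.+ lower p j)
            ≡⟨ cong (λ l → n j ℕ.* c i ℕ.+ n i ℕ.* l) (lower-suc e) ⟨
          lowerTotal i j ∎
          where open ≡-Reasoning

    IsIdeal : Chain 𝒯 G → Set
    IsIdeal K = Σ (∀ i → Carrier (V i)) λ v → (∀ i → Centroids.Median (γ i) (v i)) ×
                (∀ {i p} (a : Adj i p) → attach K i p a ≡ v i)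

    chainWiener : Chain 𝒯 G → ℕ
    chainWiener K = TreeMetricProperties.wiener (Distance.chainMetric K)

    ideal-total≤ : ∀ {K} → IsIdeal K → ∀ K′ i j → total K i j ℕ.≤ total K′ i j
    ideal-total≤ {K} (v , v-median , attach≡v) K′ i j with i Fin.≟ j
    -- Distances within G_i are the same in all chains.
    ... | yes refl = ℕ.≤-reflexive (trans (total-near K i) (sym (total-near K′ i)))
    ... | no i≢j   = ℕ.≤-trans (ℕ.≤-reflexive (Ideal.total≡lowerTotal K v v-median attach≡v i≢j))
                               (lowerTotal≤total K′ i≢j)

    ideal⇒minimal : ∀ {K} → IsIdeal K → ∀ K′ → chainWiener K ℕ.≤ chainWiener K′
    ideal⇒minimal {K} ideal K′ = subst₂ ℕ._≤_ (sym (wiener≡∑total K)) (sym (wiener≡∑total K′))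
      (∑-mono-≤ (allFin k) λ i → ∑-mono-≤ (allFin k) (ideal-total≤ ideal K′ i))

    -- The ideal chain is minimal in every term, so equality of the double sums passes first to the
    -- rows and then to the entries.
    minimal⇒tight : ∀ {K K₀} → IsIdeal K₀ → chainWiener K ℕ.≤ chainWiener K₀ → Tightness K
    minimal⇒tight {K} {K₀} ideal@(v , v-median , attach≡v) W≤ i j i≢j = ℕ.≤-reflexive (trans
      (∑-≤⇒≗ (allFin k) (ideal-total≤ ideal K i) (ℕ.≤-reflexive row≡) (∈-allFin j))
      (Ideal.total≡lowerTotal K₀ v v-median attach≡v i≢j))
      where
      row≡ : ∑ (allFin k) (total K i) ≡ ∑ (allFin k) (total K₀ i)
      row≡ = ∑-≤⇒≗ (allFin k) (λ i → ∑-mono-≤ (allFin k) (ideal-total≤ ideal K i))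
        (subst₂ ℕ._≤_ (wiener≡∑total K) (wiener≡∑total K₀) W≤) (∈-allFin i)

-- Chains with minimal Kemeny's constant

another : ∀ {k} → 2 ≤ k → (i : Fin k) → ∃[ j ] i ≢ j
another (s≤s (s≤s _)) Fin.zero    = Fin.suc Fin.zero , λ ()
another (s≤s (s≤s _)) (Fin.suc i) = Fin.zero , λ ()

proposition3p17 : (k : ℕ) → 2 ≤ k →
    (𝒯 : Graph (fin k)) → IsTree 𝒯 →
    (V : Fin k → FinSet) (G : (i : Fin k) → Graph (V i)) → (∀ i → IsTree (G i)) →
    (C : Chain 𝒯 G) →
    AttainsMinimum C ⇔ (BridgesJoinCentroids C × BridgeVerticesSingleton C)
proposition3p17 k 2≤k 𝒯 𝒯-tree V G G-tree C = mk⇔ minimum⇒ ⇒minimum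
  where
  τ : TreeMetric 𝒯
  τ = treeMetric 𝒯 𝒯-tree

  γ : ∀ i → TreeMetric (G i)
  γ i = treeMetric (G i) (G-tree i)

  module 𝕋 = TreeMetricProperties τ
  module 𝔾 i = TreeMetricProperties (γ i)
  open Graph 𝒯 using (Adj; adj-sym)
  open Chain
  open Centroids using (Median; centroid⇒median; median⇒centroid)

  root : ∀ i → Carrier (V i)
  root i = proj₁ (proj₁ (G-tree i))

  med : ∀ i → Carrier (V i)
  med i = argmin (𝔾.transmission i) (root i) (elements (V i))

  median : ∀ i → Median (γ i) (med i)
  median i u = All.lookup (f[argmin]≤f[xs] {f = 𝔾.transmission i} (root i) (elements (V i)))
                          (FinSet.complete (V i) u)

  open ChainMetric τ γ
  open Wiener med median

  -- As k is at least 2, every G_i is incident to a bridge.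
  neighbour : ∀ i → ∃[ p ] Adj i p
  neighbour i with another 2≤k i
  ... | j , i≢j with 𝕋.parent i≢j
  ... | p , a , _ = p , a

  i₀ : Fin k
  i₀ = proj₁ (proj₁ 𝒯-tree)

  -- Two vertices in different G_i, present even if each G_i is a single vertex; they make the
  -- factor 2 (n - 1) positive.
  distinct : (i₀ , root i₀) ≢ (proj₁ (another 2≤k i₀) , root (proj₁ (another 2≤k i₀)))
  distinct e = proj₂ (another 2≤k i₀) (cong proj₁ e)

  -- The competitor that meets every lower bound.
  medianChain : Chain 𝒯 G
  medianChain = record { attach = λ i _ _ → med i }

  minimum⇒ : AttainsMinimum C → BridgesJoinCentroids C × BridgeVerticesSingleton C
  minimum⇒ minimum = centroids , singleton
    where
    tight : Tightness C
    tight = minimal⇒tight {C} {medianChain} (med , median , λ _ → refl)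
      (κ≤⇒wiener≤ (Distance.chainMetric C) (Distance.chainMetric medianChain) distinct (minimum medianChain))

    centroids : BridgesJoinCentroids C
    centroids (bridge {i} {j} e) =
      median⇒centroid (γ i) (tight⇒attach-median C tight e) ,
      median⇒centroid (γ j) (tight⇒attach-median C tight (adj-sym e))

    singleton : BridgeVerticesSingleton C
    singleton i with neighbour i
    ... | p , a = attach C i p a , λ u → mk⇔
      (λ { (_ , bridge b) → tight⇒attach-≡ C tight b a })
      (λ { refl → _ , bridge a })

  ⇒minimum : BridgesJoinCentroids C × BridgeVerticesSingleton C → AttainsMinimum C
  ⇒minimum (centroids , singleton) C′ =
    wiener≤⇒κ≤ (Distance.chainMetric C) (Distance.chainMetric C′) distinct (ideal⇒minimal {C} ideal C′)
    where
    attach≡ : ∀ {i p} (a : Adj i p) → attach C i p a ≡ proj₁ (singleton i)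
    attach≡ {i} a = Equivalence.to (proj₂ (singleton i) _) (_ , bridge a)

    ideal : IsIdeal C
    ideal = proj₁ ∘ singleton ,
      -- One bridge at i is enough: its endpoint in G_i is a centroid and equals the vertex of the
      -- singleton.
      (λ i → subst (Median (γ i)) (attach≡ (proj₂ (neighbour i)))
        (centroid⇒median (γ i) (proj₁ (centroids (bridge (proj₂ (neighbour i))))))) ,
      attach≡
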